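{- Let $G$ be a profinite group and let $\mathcal U$ be the set of all open normal subgroups of $G$. Then the category ${}_G\mathsf{Ab}^{\mathrm d}$ of discrete $G$-modules and the category $\mathsf{Mack}^{\mathcal U\text{ - }\mathrm{Gal}}(\mathrm{Grp}(G)^{\mathrm f},\mathsf{Ab})$ of Mackey functors on the open subgroups of $G$ having $\mathcal U$-Galois descent are equivalent.
   Context: ${}^gH=gHg^{ -1}$, $H^g=g^{ -1}Hg$. A Mackey functor $\Phi:\mathrm{Grp}(G)^{\mathrm f}\to\mathsf{Ab}$ consists of an abelian group $\Phi(H)$ for each open subgroup $H\le G$ and, for all open subgroups $I\le H$ and $g\in G$, homomorphisms $\mathrm{res}_{I,H}:\Phi(H)\to\Phi(I)$, $\mathrm{ind}_{H,I}:\Phi(I)\to\Phi(H)$, $\mathrm{con}_{g,H}:\Phi(H)\to\Phi({}^gH)$ with: $\mathrm{res}_{H,H}=\mathrm{ind}_{H,H}=\mathrm{id}$, $\mathrm{con}_{h,H}=\mathrm{id}$ for $h\in H$; $\mathrm{res}_{J,I}\mathrm{res}_{I,H}=\mathrm{res}_{J,H}$, $\mathrm{ind}_{H,I}\mathrm{ind}_{I,J}=\mathrm{ind}_{H,J}$, $\mathrm{con}_{g',{}^gH}\mathrm{con}_{g,H}=\mathrm{con}_{g'g,H}$; $\mathrm{con}_{g,I}\mathrm{res}_{I,H}=\mathrm{res}_{{}^gI,{}^gH}\mathrm{con}_{g,H}$, $\mathrm{con}_{g,H}\mathrm{ind}_{H,I}=\mathrm{ind}_{{}^gH,{}^gI}\mathrm{con}_{g,I}$;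 and the Mackey formula $\mathrm{res}_{I,H}\mathrm{ind}_{H,J}=\sum_{h}\mathrm{ind}_{I,I\cap{}^hJ}\,\mathrm{con}_{h,I^h\cap J}\,\mathrm{res}_{I^h\cap J,J}$ ($h$ over representatives of $I\backslash H/J$) for open $I,J\le H$. Morphisms are families of homomorphisms commuting with res, ind, con. $\Phi$ has $\mathcal U$-Galois descent if for every open $H\le G$ and every open normal subgroup $U$ of $G$ with $U\le H$ the map $\mathrm{res}_{U,H}:\Phi(H)\to\Phi(U)^{H/U}$ is an isomorphism, where $H/U$ acts on $\Phi(U)$ via con. $\mathsf{Mack}^{\mathcal U\text{ - }\mathrm{Gal}}(\mathrm{Grp}(G)^{\mathrm f},\mathsf{Ab})$ is the full subcategory of such $\Phi$. -}

module Defs where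

open import Algebra.Bundles using (Group; AbelianGroup)
open import Algebra.Morphism.Bundles using (GroupHomomorphism)
open import Algebra.Morphism.Structures using (module GroupMorphisms)
import Algebra.Properties.Group as GroupProperties
open import Data.Empty using (⊥)
open import Data.List.Base using (List; []; _∷_)
open import Data.List.Relation.Unary.All using (All)
open import Data.List.Relation.Unary.AllPairs using (AllPairs)
open import Data.List.Relation.Unary.Any using (Any)
open import Data.Product.Base using (Σ; ∃-syntax; _×_; _,_; proj₁; proj₂)
open import Data.Product.Relation.Binary.Pointwise.NonDependent using (_×ₛ_)
open import Data.Sum.Base using (_⊎_)
open import Data.Unit.Polymorphic.Base using (⊤; tt)
open import Function.Bundles using (Func)
open import Level using (Level; suc; _⊔_)
open import Relation.Binary.Bundles using (Setoid)
open import Relation.Binary.Structures using (IsEquivalence)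
open import Relation.Nullary.Negation.Core using (¬_)
import Relation.Binary.Reasoning.Setoid as SetoidReasoning

record Category (o h e : Level) : Set (suc (o ⊔ h ⊔ e)) where
  infix  4 _≈_ _⇒_
  infixr 9 _∘_
  field
    Obj : Set o
    _⇒_ : Obj → Obj → Set h
    _≈_ : ∀ {A B} → A ⇒ B → A ⇒ B → Set e
    id  : ∀ {A} → A ⇒ A
    _∘_ : ∀ {A B C} → B ⇒ C → A ⇒ B → A ⇒ C

    equiv     : ∀ {A B} → IsEquivalence (_≈_ {A} {B})
    ∘-resp-≈  : ∀ {A B C} {f f′ : B ⇒ C} {g g′ : A ⇒ B} →
                f ≈ f′ → g ≈ g′ → f ∘ g ≈ f′ ∘ g′
    assoc     : ∀ {A B C D} {f : A ⇒ B} {g : B ⇒ C} {h : C ⇒ D} →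
                (h ∘ g) ∘ f ≈ h ∘ (g ∘ f)
    identityˡ : ∀ {A B} {f : A ⇒ B} → id ∘ f ≈ f
    identityʳ : ∀ {A B} {f : A ⇒ B} → f ∘ id ≈ f

record Functor {o h e o′ h′ e′} (C : Category o h e) (D : Category o′ h′ e′)
       : Set (o ⊔ h ⊔ e ⊔ o′ ⊔ h′ ⊔ e′) where
  private
    module C = Category C
    module D = Category D
  field
    F₀           : C.Obj → D.Obj
    F₁           : ∀ {A B} → A C.⇒ B → F₀ A D.⇒ F₀ B
    F-resp-≈     : ∀ {A B} {f g : A C.⇒ B} → f C.≈ g → F₁ f D.≈ F₁ g
    identity     : ∀ {A} → F₁ (C.id {A}) D.≈ D.id
    homomorphism : ∀ {X Y Z} {f : X C.⇒ Y} {g : Y C.⇒ Z} →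
                   F₁ (g C.∘ f) D.≈ F₁ g D.∘ F₁ f

idF : ∀ {o h e} {C : Category o h e} → Functor C C
idF {C = C} = record
  { F₀ = λ A → A ; F₁ = λ f → f ; F-resp-≈ = λ p → p
  ; identity = IsEquivalence.refl equiv ; homomorphism = IsEquivalence.refl equiv }
  where open Category C

_∘F_ : ∀ {o h e o′ h′ e′ o″ h″ e″} {C : Category o h e} {D : Category o′ h′ e′}
       {E : Category o″ h″ e″} → Functor D E → Functor C D → Functor C E
_∘F_ {E = E} G F = record
  { F₀           = λ A → G.F₀ (F.F₀ A)
  ; F₁           = λ f → G.F₁ (F.F₁ f)
  ; F-resp-≈     = λ p → G.F-resp-≈ (F.F-resp-≈ p)
  ; identity     = trans (G.F-resp-≈ F.identity) G.identity
  ; homomorphism = trans (G.F-resp-≈ F.homomorphism) G.homomorphism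
  }
  where
  module F = Functor F
  module G = Functor G
  trans : ∀ {A B} {f g h : Category._⇒_ E A B} →
          Category._≈_ E f g → Category._≈_ E g h → Category._≈_ E f h
  trans = IsEquivalence.trans (Category.equiv E)

record NaturalIsomorphism {o h e o′ h′ e′} {C : Category o h e} {D : Category o′ h′ e′}
       (F G : Functor C D) : Set (o ⊔ h ⊔ e ⊔ o′ ⊔ h′ ⊔ e′) where
  private
    module C = Category C
    module D = Category D
    module F = Functor F
    module G = Functor G
  field
    η       : ∀ X → F.F₀ X D.⇒ G.F₀ X
    η⁻¹     : ∀ X → G.F₀ X D.⇒ F.F₀ X
    isoˡ    : ∀ X → η⁻¹ X D.∘ η X D.≈ D.id
    isoʳ    : ∀ X → η X D.∘ η⁻¹ X D.≈ D.id
    commute : ∀ {X Y} (f : X C.⇒ Y) → η Y D.∘ F.F₁ f D.≈ G.F₁ f D.∘ η X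

record Equivalence {o h e o′ h′ e′} (C : Category o h e) (D : Category o′ h′ e′)
       : Set (o ⊔ h ⊔ e ⊔ o′ ⊔ h′ ⊔ e′) where
  field
    F      : Functor C D
    G      : Functor D C
    unit   : NaturalIsomorphism idF (G ∘F F)
    counit : NaturalIsomorphism (F ∘F G) idF

FullSubcategory : ∀ {o h e p} (C : Category o h e) → (Category.Obj C → Set p) →
                  Category (o ⊔ p) h e
FullSubcategory C P = record
  { Obj       = Σ Obj P
  ; _⇒_       = λ A B → proj₁ A ⇒ proj₁ B
  ; _≈_       = _≈_
  ; id        = id
  ; _∘_       = _∘_
  ; equiv     = equiv
  ; ∘-resp-≈  = ∘-resp-≈
  ; assoc     = assoc
  ; identityˡ = identityˡ
  ; identityʳ = identityʳ
  }
  where open Category C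

record Subset {ℓ} (S : Setoid ℓ ℓ) : Set (suc ℓ) where
  open Setoid S
  field
    member : Carrier → Set ℓ
    resp   : ∀ {x y} → x ≈ y → member x → member y

module _ {ℓ} {S : Setoid ℓ ℓ} where
  open Setoid S

  infix 4 _∈_ _⊆_

  _∈_ : Carrier → Subset S → Set ℓ
  x ∈ A = Subset.member A x

  _⊆_ : Subset S → Subset S → Set ℓ
  A ⊆ B = ∀ {x} → x ∈ A → x ∈ B

  full : Subset S
  full = record { member = λ _ → ⊤ ; resp = λ _ _ → tt }

  _∩_ : Subset S → Subset S → Subset S
  A ∩ B = record
    { member = λ x → x ∈ A × x ∈ B
    ; resp   = λ e (a , b) → Subset.resp A e a , Subset.resp B e b }

  ⋃ : {I : Set ℓ} → (I → Subset S) → Subset S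
  ⋃ U = record
    { member = λ x → ∃[ i ] x ∈ U i
    ; resp   = λ e (i , u) → i , Subset.resp (U i) e u }

preimage : ∀ {ℓ} {S T : Setoid ℓ ℓ} → Func S T → Subset T → Subset S
preimage f A = record
  { member = λ x → Func.to f x ∈ A
  ; resp   = λ e → Subset.resp A (Func.cong f e) }

-- The empty set is open as the union of the empty family.
record Topology {ℓ} (S : Setoid ℓ ℓ) : Set (suc (suc ℓ)) where
  field
    IsOpen    : Subset S → Set (suc ℓ)
    open-resp : ∀ {A B} → A ⊆ B → B ⊆ A → IsOpen A → IsOpen B
    open-full : IsOpen full
    open-∩    : ∀ {A B} → IsOpen A → IsOpen B → IsOpen (A ∩ B)
    open-⋃    : ∀ {I : Set ℓ} (U : I → Subset S) → (∀ i → IsOpen (U i)) → IsOpen (⋃ U)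

Discrete : ∀ {ℓ} (S : Setoid ℓ ℓ) → Topology S
Discrete S = record
  { IsOpen = λ _ → ⊤ ; open-resp = λ _ _ _ → tt ; open-full = tt
  ; open-∩ = λ _ _ → tt ; open-⋃ = λ _ _ → tt }

Product : ∀ {ℓ} {S T : Setoid ℓ ℓ} → Topology S → Topology T → Topology (S ×ₛ T)
Product {S = S} {T = T} 𝒮 𝒯 = record
  { IsOpen    = λ W → ∀ {x y} → (x , y) ∈ W → ∃[ A ] ∃[ B ]
                  𝒮.IsOpen A × 𝒯.IsOpen B × x ∈ A × y ∈ B ×
                  (∀ {a b} → a ∈ A → b ∈ B → (a , b) ∈ W)
  ; open-resp = λ V⊆W W⊆V o w → let (A , B , oA , oB , x , y , box) = o (W⊆V w) in
                  A , B , oA , oB , x , y , λ a b → V⊆W (box a b)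
  ; open-full = λ _ → full , full , 𝒮.open-full , 𝒯.open-full , tt , tt , λ _ _ → tt
  ; open-∩    = λ o o′ (w , w′) →
                  let (A  , B  , oA  , oB  , x  , y  , box ) = o  w
                      (A′ , B′ , oA′ , oB′ , x′ , y′ , box′) = o′ w′ in
                  A ∩ A′ , B ∩ B′ , 𝒮.open-∩ oA oA′ , 𝒯.open-∩ oB oB′ , (x , x′) , (y , y′) ,
                  λ (a , a′) (b , b′) → box a b , box′ a′ b′
  ; open-⋃    = λ U o (i , u) → let (A , B , oA , oB , x , y , box) = o i u in
                  A , B , oA , oB , x , y , λ a b → i , box a b
  }
  where
  module 𝒮 = Topology 𝒮
  module 𝒯 = Topology 𝒯

Continuous : ∀ {ℓ} {S T : Setoid ℓ ℓ} → Topology S → Topology T → Func S T → Set (suc ℓ)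
Continuous 𝒮 𝒯 f = ∀ A → Topology.IsOpen 𝒯 A → Topology.IsOpen 𝒮 (preimage f A)

module _ {ℓ} {S : Setoid ℓ ℓ} (𝒮 : Topology S) where
  open Setoid S
  open Topology 𝒮

  Compact : Set (suc ℓ)
  Compact = ∀ {I : Set ℓ} (U : I → Subset S) → (∀ i → IsOpen (U i)) →
            (∀ x → ∃[ i ] x ∈ U i) → ∃[ is ] (∀ x → Any (λ i → x ∈ U i) is)

  Hausdorff : Set (suc ℓ)
  Hausdorff = ∀ x y → ¬ x ≈ y → ∃[ A ] ∃[ B ]
              IsOpen A × IsOpen B × x ∈ A × y ∈ B × (∀ {z} → z ∈ A → z ∈ B → ⊥)

  Connected : Subset S → Set (suc ℓ)
  Connected C = ∀ A B → IsOpen A → IsOpen B →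
                (∀ {x} → x ∈ C → x ∈ A ⊎ x ∈ B) →
                (∀ {x} → x ∈ C → x ∈ A → x ∈ B → ⊥) →
                (∃[ x ] x ∈ C × x ∈ A) → (∃[ x ] x ∈ C × x ∈ B) → ⊥

  TotallyDisconnected : Set (suc ℓ)
  TotallyDisconnected = ∀ C → Connected C → ∀ {x y} → x ∈ C → y ∈ C → x ≈ y

record ProfiniteGroup (ℓ : Level) : Set (suc (suc ℓ)) where
  field
    group    : Group ℓ ℓ
  open Group group public
  field
    topology : Topology setoid
  open Topology topology public

  mul : Func (setoid ×ₛ setoid) setoid
  mul = record { to = λ (x , y) → x ∙ y ; cong = λ (p , q) → ∙-cong p q }

  inv : Func setoid setoid
  inv = record { to = _⁻¹ ; cong = ⁻¹-cong }

  field
    ∙-continuous        : Continuous (Product topology topology) topology mul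
    ⁻¹-continuous       : Continuous topology topology inv
    compact             : Compact topology
    hausdorff           : Hausdorff topology
    totallyDisconnected : TotallyDisconnected topology

module OpenSubgroups {ℓ} (G : ProfiniteGroup ℓ) where
  open ProfiniteGroup G
  open GroupProperties group using (⁻¹-anti-homo-∙; ⁻¹-involutive; inverseˡ-unique)
  open SetoidReasoning setoid

  record OpenSubgroup : Set (suc ℓ) where
    field
      subset    : Subset setoid
      isOpen    : IsOpen subset
      ε-closed  : ε ∈ subset
      ∙-closed  : ∀ {x y} → x ∈ subset → y ∈ subset → x ∙ y ∈ subset
      ⁻¹-closed : ∀ {x} → x ∈ subset → x ⁻¹ ∈ subset
    open Subset subset public using (resp)

  infix 4 _∈ₒ_ _≤_ _≐_

  _∈ₒ_ : Carrier → OpenSubgroup → Set ℓ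
  x ∈ₒ H = x ∈ OpenSubgroup.subset H

  _≤_ : OpenSubgroup → OpenSubgroup → Set ℓ
  I ≤ H = ∀ {x} → x ∈ₒ I → x ∈ₒ H

  _≐_ : OpenSubgroup → OpenSubgroup → Set ℓ
  I ≐ H = I ≤ H × H ≤ I

  IsNormal : OpenSubgroup → Set ℓ
  IsNormal U = ∀ g {x} → x ∈ₒ U → g ∙ x ∙ g ⁻¹ ∈ₒ U

  private
    left : Carrier → Func setoid setoid
    left a = record { to = a ∙_ ; cong = ∙-congˡ }

    right : Carrier → Func setoid setoid
    right b = record { to = _∙ b ; cong = ∙-congʳ }

    left-continuous : ∀ a → Continuous topology topology (left a)
    left-continuous a A oA = open-resp {⋃ V} {preimage (left a) A}
      (λ ((_ , y∈) , z∈) → let (_ , _ , _ , _ , a∈ , _ , box) = nbhd y∈ in box a∈ z∈)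
      (λ {x} x∈ → (x , x∈) , (let (_ , _ , _ , _ , _ , x∈V , _) = nbhd x∈ in x∈V))
      (open-⋃ V (λ (_ , y∈) → let (_ , _ , _ , oV , _) = nbhd y∈ in oV))
      where
      nbhd : ∀ {y} → a ∙ y ∈ A → _
      nbhd {y} = ∙-continuous A oA {a} {y}
      V : (∃[ y ] a ∙ y ∈ A) → Subset setoid
      V (_ , y∈) = proj₁ (proj₂ (nbhd y∈))

    right-continuous : ∀ b → Continuous topology topology (right b)
    right-continuous b A oA = open-resp {⋃ V} {preimage (right b) A}
      (λ ((_ , y∈) , z∈) → let (_ , _ , _ , _ , _ , b∈ , box) = nbhd y∈ in box z∈ b∈)
      (λ {x} x∈ → (x , x∈) , (let (_ , _ , _ , _ , x∈V , _) = nbhd x∈ in x∈V))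
      (open-⋃ V (λ (_ , y∈) → let (_ , _ , oV , _) = nbhd y∈ in oV))
      where
      nbhd : ∀ {y} → y ∙ b ∈ A → _
      nbhd {y} = ∙-continuous A oA {y} {b}
      V : (∃[ y ] y ∙ b ∈ A) → Subset setoid
      V (_ , y∈) = proj₁ (nbhd y∈)

    cancel : ∀ {a b} x y → b ∙ a ≈ ε → (x ∙ b) ∙ (a ∙ y) ≈ x ∙ y
    cancel {a} {b} x y ba = begin
      (x ∙ b) ∙ (a ∙ y) ≈⟨ assoc x b (a ∙ y) ⟩
      x ∙ (b ∙ (a ∙ y)) ≈⟨ ∙-congˡ (assoc b a y) ⟨
      x ∙ ((b ∙ a) ∙ y) ≈⟨ ∙-congˡ (∙-congʳ ba) ⟩
      x ∙ (ε ∙ y)       ≈⟨ ∙-congˡ (identityˡ y) ⟩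
      x ∙ y             ∎

    sandwich-∙ : ∀ {a b} x y → b ∙ a ≈ ε → (a ∙ x ∙ b) ∙ (a ∙ y ∙ b) ≈ a ∙ (x ∙ y) ∙ b
    sandwich-∙ {a} {b} x y ba = begin
      (a ∙ x ∙ b) ∙ (a ∙ y ∙ b) ≈⟨ assoc (a ∙ x ∙ b) (a ∙ y) b ⟨
      (a ∙ x ∙ b) ∙ (a ∙ y) ∙ b ≈⟨ ∙-congʳ (cancel (a ∙ x) y ba) ⟩
      a ∙ x ∙ y ∙ b             ≈⟨ ∙-congʳ (assoc a x y) ⟩
      a ∙ (x ∙ y) ∙ b           ∎

    sandwich-ε : ∀ {a b} → a ∙ b ≈ ε → a ∙ ε ∙ b ≈ ε
    sandwich-ε ab = trans (∙-congʳ (identityʳ _)) ab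

    sandwich-⁻¹ : ∀ {a b} x → a ∙ b ≈ ε → b ∙ a ≈ ε → (a ∙ x ∙ b) ⁻¹ ≈ a ∙ x ⁻¹ ∙ b
    sandwich-⁻¹ {a} {b} x ab ba = sym (inverseˡ-unique _ _ (begin
      (a ∙ x ⁻¹ ∙ b) ∙ (a ∙ x ∙ b) ≈⟨ sandwich-∙ (x ⁻¹) x ba ⟩
      a ∙ (x ⁻¹ ∙ x) ∙ b           ≈⟨ ∙-congʳ (∙-congˡ (inverseˡ x)) ⟩
      a ∙ ε ∙ b                    ≈⟨ sandwich-ε ab ⟩
      ε                            ∎))

    sandwich : ∀ a b → a ∙ b ≈ ε → b ∙ a ≈ ε → OpenSubgroup → OpenSubgroup
    sandwich a b ab ba H = record
      { subset    = record
          { member = λ x → a ∙ x ∙ b ∈ₒ H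
          ; resp   = λ e → resp (∙-congʳ (∙-congˡ e)) }
      ; isOpen    = left-continuous a (preimage (right b) subset)
                      (right-continuous b subset isOpen)
      ; ε-closed  = resp (sym (sandwich-ε ab)) ε-closed
      ; ∙-closed  = λ x∈ y∈ → resp (sandwich-∙ _ _ ba) (∙-closed x∈ y∈)
      ; ⁻¹-closed = λ x∈ → resp (sandwich-⁻¹ _ ab ba) (⁻¹-closed x∈)
      }
      where open OpenSubgroup H

  -- gHg⁻¹, as the set of x with g⁻¹xg ∈ H.
  conj : Carrier → OpenSubgroup → OpenSubgroup
  conj g = sandwich (g ⁻¹) g (inverseˡ g) (inverseʳ g)

  -- g⁻¹Hg, as the set of x with gxg⁻¹ ∈ H.
  _^_ : OpenSubgroup → Carrier → OpenSubgroup
  H ^ g = sandwich g (g ⁻¹) (inverseʳ g) (inverseˡ g) H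

  _∩ₒ_ : OpenSubgroup → OpenSubgroup → OpenSubgroup
  I ∩ₒ J = record
    { subset    = I.subset ∩ J.subset
    ; isOpen    = open-∩ I.isOpen J.isOpen
    ; ε-closed  = I.ε-closed , J.ε-closed
    ; ∙-closed  = λ (x , x′) (y , y′) → I.∙-closed x y , J.∙-closed x′ y′
    ; ⁻¹-closed = λ (x , x′) → I.⁻¹-closed x , J.⁻¹-closed x′
    }
    where
    module I = OpenSubgroup I
    module J = OpenSubgroup J

  conj-mono : ∀ g {I H} → I ≤ H → conj g I ≤ conj g H
  conj-mono g I≤H x∈ = I≤H x∈

  conj-cong : ∀ {g g′} H → g ≈ g′ → conj g H ≐ conj g′ H
  conj-cong H e =
      resp (∙-cong (∙-congʳ (⁻¹-cong e)) e)
    , resp (∙-cong (∙-congʳ (⁻¹-cong (sym e))) (sym e))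
    where open OpenSubgroup H

  private
    undo : ∀ {a b} x → a ∙ b ≈ ε → a ∙ (b ∙ x ∙ a) ∙ b ≈ x
    undo {a} {b} x ab = begin
      a ∙ (b ∙ x ∙ a) ∙ b   ≈⟨ ∙-congʳ (assoc a (b ∙ x) a) ⟨
      a ∙ (b ∙ x) ∙ a ∙ b   ≈⟨ assoc (a ∙ (b ∙ x)) a b ⟩
      a ∙ (b ∙ x) ∙ (a ∙ b) ≈⟨ ∙-cong (sym (assoc a b x)) ab ⟩
      a ∙ b ∙ x ∙ ε         ≈⟨ identityʳ _ ⟩
      a ∙ b ∙ x             ≈⟨ ∙-congʳ ab ⟩
      ε ∙ x                 ≈⟨ identityˡ x ⟩
      x                     ∎

  conj-self : ∀ {h} H → h ∈ₒ H → H ≐ conj h H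
  conj-self {h} H h∈ =
      (λ x∈ → ∙-closed (∙-closed (⁻¹-closed h∈) x∈) h∈)
    , (λ x∈ → resp (undo _ (inverseʳ h)) (∙-closed (∙-closed h∈ x∈) (⁻¹-closed h∈)))
    where open OpenSubgroup H

  conj-comp : ∀ g′ g H → conj g′ (conj g H) ≐ conj (g′ ∙ g) H
  conj-comp g′ g H = resp (eq _) , resp (sym (eq _))
    where
    open OpenSubgroup H
    eq : ∀ x → g ⁻¹ ∙ (g′ ⁻¹ ∙ x ∙ g′) ∙ g ≈ (g′ ∙ g) ⁻¹ ∙ x ∙ (g′ ∙ g)
    eq x = begin
      g ⁻¹ ∙ (g′ ⁻¹ ∙ x ∙ g′) ∙ g   ≈⟨ ∙-congʳ (assoc (g ⁻¹) (g′ ⁻¹ ∙ x) g′) ⟨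
      g ⁻¹ ∙ (g′ ⁻¹ ∙ x) ∙ g′ ∙ g   ≈⟨ assoc _ g′ g ⟩
      g ⁻¹ ∙ (g′ ⁻¹ ∙ x) ∙ (g′ ∙ g) ≈⟨ ∙-congʳ (assoc (g ⁻¹) (g′ ⁻¹) x) ⟨
      g ⁻¹ ∙ g′ ⁻¹ ∙ x ∙ (g′ ∙ g)   ≈⟨ ∙-congʳ (∙-congʳ (⁻¹-anti-homo-∙ g′ g)) ⟨
      (g′ ∙ g) ⁻¹ ∙ x ∙ (g′ ∙ g)    ∎

  conj-∩ : ∀ h I J → conj h ((I ^ h) ∩ₒ J) ≐ I ∩ₒ conj h J
  conj-∩ h I J =
      (λ (i , j) → OpenSubgroup.resp I (undo _ (inverseʳ h)) i , j)
    , (λ (i , j) → OpenSubgroup.resp I (sym (undo _ (inverseʳ h))) i , j)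

  normal-conj : ∀ g {U} → IsNormal U → conj g U ≐ U
  normal-conj g {U} n =
      (λ x∈ → resp (undo _ (inverseʳ g)) (n g x∈))
    , (λ x∈ → resp (∙-congˡ (⁻¹-involutive g)) (n (g ⁻¹) x∈))
    where open OpenSubgroup U

  -- hs lists exactly one element of each double coset in I\H/J.
  record DoubleCosetRepresentatives (I H J : OpenSubgroup) (hs : List Carrier) : Set ℓ where
    _∼_ : Carrier → Carrier → Set ℓ
    h ∼ h′ = ∃[ i ] ∃[ j ] i ∈ₒ I × j ∈ₒ J × h′ ≈ i ∙ h ∙ j
    field
      inH      : All (_∈ₒ H) hs
      covers   : ∀ {x} → x ∈ₒ H → Any (_∼ x) hs
      distinct : AllPairs (λ h h′ → ¬ h ∼ h′) hs

  -- H/U has the elements of H as carrier, two of them being equal when h⁻¹h′ ∈ U.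
  module _ (H U : OpenSubgroup) (U-normal : IsNormal U) where
    private
      module H = OpenSubgroup H
      module U = OpenSubgroup U

      _∼_ : Carrier → Carrier → Set ℓ
      h ∼ h′ = h ⁻¹ ∙ h′ ∈ₒ U

      ≈⇒∼ : ∀ {h h′} → h ≈ h′ → h ∼ h′
      ≈⇒∼ {h} e = U.resp (trans (sym (inverseˡ h)) (∙-congˡ e)) U.ε-closed

      ∼-sym : ∀ {h h′} → h ∼ h′ → h′ ∼ h
      ∼-sym {h} {h′} p = U.resp
        (trans (⁻¹-anti-homo-∙ (h ⁻¹) h′) (∙-congˡ (⁻¹-involutive h))) (U.⁻¹-closed p)

      ∼-trans : ∀ {h h′ h″} → h ∼ h′ → h′ ∼ h″ → h ∼ h″
      ∼-trans {h} {h′} {h″} p q = U.resp (cancel (h ⁻¹) h″ (inverseʳ h′)) (U.∙-closed p q)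

      normal′ : ∀ g {x} → x ∈ₒ U → g ⁻¹ ∙ x ∙ g ∈ₒ U
      normal′ g = proj₂ (normal-conj g {U} U-normal)

      ∼-∙ : ∀ {x x′ y y′} → x ∼ x′ → y ∼ y′ → (x ∙ y) ∼ (x′ ∙ y′)
      ∼-∙ {x} {x′} {y} {y′} p q = U.resp eq (U.∙-closed (normal′ y p) q)
        where
        eq : (y ⁻¹ ∙ (x ⁻¹ ∙ x′) ∙ y) ∙ (y ⁻¹ ∙ y′) ≈ (x ∙ y) ⁻¹ ∙ (x′ ∙ y′)
        eq = begin
          (y ⁻¹ ∙ (x ⁻¹ ∙ x′) ∙ y) ∙ (y ⁻¹ ∙ y′) ≈⟨ cancel _ y′ (inverseʳ y) ⟩
          y ⁻¹ ∙ (x ⁻¹ ∙ x′) ∙ y′                ≈⟨ ∙-congʳ (assoc (y ⁻¹) (x ⁻¹) x′) ⟨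
          y ⁻¹ ∙ x ⁻¹ ∙ x′ ∙ y′                  ≈⟨ assoc _ x′ y′ ⟩
          y ⁻¹ ∙ x ⁻¹ ∙ (x′ ∙ y′)                ≈⟨ ∙-congʳ (⁻¹-anti-homo-∙ x y) ⟨
          (x ∙ y) ⁻¹ ∙ (x′ ∙ y′)                 ∎

      ∼-⁻¹ : ∀ {x y} → x ∼ y → (x ⁻¹) ∼ (y ⁻¹)
      ∼-⁻¹ {x} {y} p = U.resp eq (U-normal x (∼-sym p))
        where
        eq : x ∙ (y ⁻¹ ∙ x) ∙ x ⁻¹ ≈ (x ⁻¹) ⁻¹ ∙ y ⁻¹
        eq = begin
          x ∙ (y ⁻¹ ∙ x) ∙ x ⁻¹   ≈⟨ ∙-congʳ (assoc x (y ⁻¹) x) ⟨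
          x ∙ y ⁻¹ ∙ x ∙ x ⁻¹     ≈⟨ assoc _ x (x ⁻¹) ⟩
          x ∙ y ⁻¹ ∙ (x ∙ x ⁻¹)   ≈⟨ ∙-congˡ (inverseʳ x) ⟩
          x ∙ y ⁻¹ ∙ ε            ≈⟨ identityʳ _ ⟩
          x ∙ y ⁻¹                ≈⟨ ∙-congʳ (⁻¹-involutive x) ⟨
          (x ⁻¹) ⁻¹ ∙ y ⁻¹        ∎

    Quotient : Group ℓ ℓ
    Quotient = record
      { Carrier = ∃[ h ] h ∈ₒ H
      ; _≈_     = λ (h , _) (h′ , _) → h ∼ h′
      ; _∙_     = λ (h , p) (h′ , p′) → h ∙ h′ , H.∙-closed p p′
      ; ε       = ε , H.ε-closed
      ; _⁻¹     = λ (h , p) → h ⁻¹ , H.⁻¹-closed p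
      ; isGroup = record
        { isMonoid = record
          { isSemigroup = record
            { isMagma = record
              { isEquivalence = record
                { refl = ≈⇒∼ refl ; sym = ∼-sym ; trans = ∼-trans }
              ; ∙-cong = ∼-∙ }
            ; assoc = λ _ _ _ → ≈⇒∼ (assoc _ _ _) }
          ; identity = (λ _ → ≈⇒∼ (identityˡ _)) , (λ _ → ≈⇒∼ (identityʳ _)) }
        ; inverse = (λ _ → ≈⇒∼ (inverseˡ _)) , (λ _ → ≈⇒∼ (inverseʳ _))
        ; ⁻¹-cong = ∼-⁻¹ }
      }

infix 4 _→ᴬ_

_→ᴬ_ : ∀ {ℓ} → AbelianGroup ℓ ℓ → AbelianGroup ℓ ℓ → Set ℓ
A →ᴬ B = GroupHomomorphism (AbelianGroup.rawGroup A) (AbelianGroup.rawGroup B)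

open GroupHomomorphism public using (⟦_⟧)

module _ {ℓ} {A B : AbelianGroup ℓ ℓ} where
  private
    module A = AbelianGroup A
    module B = AbelianGroup B

  mkHom : (f : A.Carrier → B.Carrier) → (∀ {x y} → x A.≈ y → f x B.≈ f y) →
          (∀ x y → f (x A.∙ y) B.≈ f x B.∙ f y) → A →ᴬ B
  mkHom f f-cong f-∙ = record
    { ⟦_⟧ = f
    ; isGroupHomomorphism = record
      { isMonoidHomomorphism = record
        { isMagmaHomomorphism = record
          { isRelHomomorphism = record { cong = f-cong } ; homo = f-∙ }
        ; ε-homo = f-ε }
      ; ⁻¹-homo = λ x → inverseˡ-unique _ _ (B.trans (B.sym (f-∙ (x A.⁻¹) x))
                    (B.trans (f-cong (A.inverseˡ x)) f-ε)) }
    }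
    where
    open GroupProperties B.group using (inverseˡ-unique; identityˡ-unique)
    f-ε : f A.ε B.≈ B.ε
    f-ε = identityˡ-unique _ _ (B.trans (B.sym (f-∙ A.ε A.ε)) (f-cong (A.identityˡ A.ε)))

idᴬ : ∀ {ℓ} {A : AbelianGroup ℓ ℓ} → A →ᴬ A
idᴬ {A = A} = mkHom {A = A} {B = A} (λ x → x) (λ p → p) (λ _ _ → AbelianGroup.refl A)

_∘ᴬ_ : ∀ {ℓ} {A B C : AbelianGroup ℓ ℓ} → B →ᴬ C → A →ᴬ B → A →ᴬ C
_∘ᴬ_ {A = A} {B} {C} g f = mkHom {A = A} {B = C} (λ x → ⟦ g ⟧ (⟦ f ⟧ x))
  (λ p → g.⟦⟧-cong (f.⟦⟧-cong p))
  (λ x y → AbelianGroup.trans C (g.⟦⟧-cong (f.homo x y)) (g.homo _ _))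
  where
  module f = GroupHomomorphism f
  module g = GroupHomomorphism g

record Action {ℓ} (Γ : Group ℓ ℓ) (M : AbelianGroup ℓ ℓ) : Set ℓ where
  private
    module Γ = Group Γ
    module M = AbelianGroup M
  infixr 8 _·_
  field
    _·_     : Γ.Carrier → M.Carrier → M.Carrier
    ·-cong  : ∀ {g h x y} → g Γ.≈ h → x M.≈ y → g · x M.≈ h · y
    ·-ε     : ∀ x → Γ.ε · x M.≈ x
    ·-assoc : ∀ g h x → (g Γ.∙ h) · x M.≈ g · h · x
    ·-∙     : ∀ g x y → g · (x M.∙ y) M.≈ (g · x) M.∙ (g · y)

  ·-hom : Γ.Carrier → M →ᴬ M
  ·-hom g = mkHom {A = M} {B = M} (g ·_) (·-cong Γ.refl) (·-∙ g)

  Invariants : AbelianGroup ℓ ℓ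
  Invariants = record
    { Carrier = ∃[ x ] (∀ g → g · x M.≈ x)
    ; _≈_     = λ (x , _) (y , _) → x M.≈ y
    ; _∙_     = λ (x , p) (y , q) → x M.∙ y ,
                  λ g → M.trans (·-∙ g x y) (M.∙-cong (p g) (q g))
    ; ε       = M.ε , λ g → GroupHomomorphism.ε-homo (·-hom g)
    ; _⁻¹     = λ (x , p) → x M.⁻¹ ,
                  λ g → M.trans (GroupHomomorphism.⁻¹-homo (·-hom g) x) (M.⁻¹-cong (p g))
    ; isAbelianGroup = record
      { isGroup = record
        { isMonoid = record
          { isSemigroup = record
            { isMagma = record
              { isEquivalence = record { refl = M.refl ; sym = M.sym ; trans = M.trans }
              ; ∙-cong = M.∙-cong }
            ; assoc = λ _ _ _ → M.assoc _ _ _ }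
          ; identity = (λ _ → M.identityˡ _) , (λ _ → M.identityʳ _) }
        ; inverse = (λ _ → M.inverseˡ _) , (λ _ → M.inverseʳ _)
        ; ⁻¹-cong = M.⁻¹-cong }
      ; comm = λ _ _ → M.comm _ _ }
    }

module _ {ℓ} (G : ProfiniteGroup ℓ) where
  private module G = ProfiniteGroup G

  record DiscreteModule : Set (suc ℓ) where
    field
      M      : AbelianGroup ℓ ℓ
      action : Action G.group M
    open AbelianGroup M public
    open Action action public

    actionMap : Func (G.setoid ×ₛ setoid) setoid
    actionMap = record { to = λ (g , x) → g · x ; cong = λ (p , q) → ·-cong p q }

    field
      continuous : Continuous (Product G.topology (Discrete setoid)) (Discrete setoid) actionMap

  record ModuleHom (M N : DiscreteModule) : Set ℓ where
    private
      module M = DiscreteModule M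
      module N = DiscreteModule N
    field
      hom         : M.M →ᴬ N.M
      equivariant : ∀ g x → ⟦ hom ⟧ (g M.· x) N.≈ g N.· ⟦ hom ⟧ x

  DiscreteModules : Category (suc ℓ) ℓ ℓ
  DiscreteModules = record
    { Obj       = DiscreteModule
    ; _⇒_       = ModuleHom
    ; _≈_       = λ {M} {N} f g →
                    ∀ x → DiscreteModule._≈_ N (⟦ ModuleHom.hom f ⟧ x) (⟦ ModuleHom.hom g ⟧ x)
    ; id        = λ {M} → record
                    { hom = idᴬ {A = DiscreteModule.M M}
                    ; equivariant = λ _ _ → DiscreteModule.refl M }
    ; _∘_       = λ {L} {M} {N} g f → record
                    { hom = _∘ᴬ_ {A = DiscreteModule.M L} {DiscreteModule.M M} {DiscreteModule.M N}
                              (ModuleHom.hom g) (ModuleHom.hom f)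
                    ; equivariant = λ h x → DiscreteModule.trans N
                        (GroupHomomorphism.⟦⟧-cong (ModuleHom.hom g) (ModuleHom.equivariant f h x))
                        (ModuleHom.equivariant g h _) }
    ; equiv     = λ {M} {N} → record
                    { refl  = λ _ → DiscreteModule.refl N
                    ; sym   = λ p x → DiscreteModule.sym N (p x)
                    ; trans = λ p q x → DiscreteModule.trans N (p x) (q x) }
    ; ∘-resp-≈  = λ {L} {M} {N} {f} p q x → DiscreteModule.trans N
                    (GroupHomomorphism.⟦⟧-cong (ModuleHom.hom f) (q x)) (p _)
    ; assoc     = λ {_} {_} {_} {N} _ → DiscreteModule.refl N
    ; identityˡ = λ {_} {N} _ → DiscreteModule.refl N
    ; identityʳ = λ {_} {N} _ → DiscreteModule.refl N
    }

∑ : ∀ {ℓ} (A : AbelianGroup ℓ ℓ) {X : Set ℓ} → List X → (X → AbelianGroup.Carrier A) →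
    AbelianGroup.Carrier A
∑ A []       f = AbelianGroup.ε A
∑ A (x ∷ xs) f = AbelianGroup._∙_ A (f x) (∑ A xs f)

module _ {ℓ} (G : ProfiniteGroup ℓ) where
  private module G = ProfiniteGroup G
  open OpenSubgroups G

  -- Open subgroups are compared by mutual inclusion, so the equality Φ(H) = Φ(K) for
  -- H = K becomes the isomorphism `coe`, which is res along K ≤ H.  It enters each axiom
  -- whose two sides a priori lie in different groups.  Accordingly `ind-id` says that ind
  -- between equal subgroups is this identification (for K = H: ind_{H,H} = id, by `res-id`),
  -- and `con-cong` that con_{g,H} depends on g only up to the equality of G.
  record MackeyFunctor : Set (suc ℓ) where
    field
      Φ   : OpenSubgroup → AbelianGroup ℓ ℓ
      res : ∀ I H → I ≤ H → Φ H →ᴬ Φ I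
      ind : ∀ H I → I ≤ H → Φ I →ᴬ Φ H
      con : ∀ g H → Φ H →ᴬ Φ (conj g H)

    module Φ (H : OpenSubgroup) = AbelianGroup (Φ H)

    coe : ∀ {H K} → H ≐ K → Φ.Carrier H → Φ.Carrier K
    coe {H} {K} e = ⟦ res K H (proj₂ e) ⟧

    field
      res-id : ∀ H (p : H ≤ H) x → Φ._≈_ H (⟦ res H H p ⟧ x) x
      ind-id : ∀ H K (e : H ≐ K) x → Φ._≈_ K (⟦ ind K H (proj₁ e) ⟧ x) (coe {H} {K} e x)
      con-id : ∀ {h} H (h∈H : h ∈ₒ H) x →
               Φ._≈_ (conj h H) (⟦ con h H ⟧ x) (coe {H} {conj h H} (conj-self H h∈H) x)
      con-cong : ∀ {g g′} H (e : g G.≈ g′) x →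
                 Φ._≈_ (conj g′ H) (coe {conj g H} {conj g′ H} (conj-cong H e) (⟦ con g H ⟧ x))
                                   (⟦ con g′ H ⟧ x)

      res-res : ∀ J I H (p : J ≤ I) (q : I ≤ H) (r : J ≤ H) x →
                Φ._≈_ J (⟦ res J I p ⟧ (⟦ res I H q ⟧ x)) (⟦ res J H r ⟧ x)
      ind-ind : ∀ H I J (q : I ≤ H) (p : J ≤ I) (r : J ≤ H) x →
                Φ._≈_ H (⟦ ind H I q ⟧ (⟦ ind I J p ⟧ x)) (⟦ ind H J r ⟧ x)
      con-con : ∀ g′ g H x →
                Φ._≈_ (conj (g′ G.∙ g) H)
                  (coe {conj g′ (conj g H)} {conj (g′ G.∙ g) H} (conj-comp g′ g H)
                    (⟦ con g′ (conj g H) ⟧ (⟦ con g H ⟧ x)))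
                  (⟦ con (g′ G.∙ g) H ⟧ x)

      con-res : ∀ g I H (p : I ≤ H) x →
                Φ._≈_ (conj g I) (⟦ con g I ⟧ (⟦ res I H p ⟧ x))
                  (⟦ res (conj g I) (conj g H) (conj-mono g {I} {H} p) ⟧ (⟦ con g H ⟧ x))
      con-ind : ∀ g H I (p : I ≤ H) x →
                Φ._≈_ (conj g H) (⟦ con g H ⟧ (⟦ ind H I p ⟧ x))
                  (⟦ ind (conj g H) (conj g I) (conj-mono g {I} {H} p) ⟧ (⟦ con g I ⟧ x))

      mackey  : ∀ I J H (p : I ≤ H) (q : J ≤ H) hs → DoubleCosetRepresentatives I H J hs → ∀ x →
                Φ._≈_ I (⟦ res I H p ⟧ (⟦ ind H J q ⟧ x))
                  (∑ (Φ I) hs λ h →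
                    ⟦ ind I (I ∩ₒ conj h J) proj₁ ⟧
                      (coe {conj h ((I ^ h) ∩ₒ J)} {I ∩ₒ conj h J} (conj-∩ h I J)
                        (⟦ con h ((I ^ h) ∩ₒ J) ⟧
                          (⟦ res ((I ^ h) ∩ₒ J) J proj₂ ⟧ x))))

  record MackeyHom (Φ Ψ : MackeyFunctor) : Set (suc ℓ) where
    private
      module Φ = MackeyFunctor Φ
      module Ψ = MackeyFunctor Ψ
    field
      hom      : ∀ H → Φ.Φ H →ᴬ Ψ.Φ H
      comm-res : ∀ I H (p : I ≤ H) x →
                 Ψ.Φ._≈_ I (⟦ hom I ⟧ (⟦ Φ.res I H p ⟧ x)) (⟦ Ψ.res I H p ⟧ (⟦ hom H ⟧ x))
      comm-ind : ∀ H I (p : I ≤ H) x →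
                 Ψ.Φ._≈_ H (⟦ hom H ⟧ (⟦ Φ.ind H I p ⟧ x)) (⟦ Ψ.ind H I p ⟧ (⟦ hom I ⟧ x))
      comm-con : ∀ g H x →
                 Ψ.Φ._≈_ (conj g H) (⟦ hom (conj g H) ⟧ (⟦ Φ.con g H ⟧ x))
                                    (⟦ Ψ.con g H ⟧ (⟦ hom H ⟧ x))

  Mack : Category (suc ℓ) (suc ℓ) (suc ℓ)
  Mack = record
    { Obj       = MackeyFunctor
    ; _⇒_       = MackeyHom
    ; _≈_       = λ {Φ} {Ψ} f g → ∀ H x →
                    Φ._≈_ Ψ H (⟦ hom f H ⟧ x) (⟦ hom g H ⟧ x)
    ; id        = λ {Φ} → record
        { hom      = λ H → idᴬ {A = MackeyFunctor.Φ Φ H}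
        ; comm-res = λ I _ _ _ → Φ.refl Φ I
        ; comm-ind = λ H _ _ _ → Φ.refl Φ H
        ; comm-con = λ g H _ → Φ.refl Φ (conj g H) }
    ; _∘_       = λ {Φ} {Ψ} {Ω} g f → record
        { hom      = λ H → _∘ᴬ_ {A = MackeyFunctor.Φ Φ H} {MackeyFunctor.Φ Ψ H} {MackeyFunctor.Φ Ω H}
                             (hom g H) (hom f H)
        ; comm-res = λ I H p x → Φ.trans Ω I
                       (GroupHomomorphism.⟦⟧-cong (hom g I) (comm-res f I H p x)) (comm-res g I H p _)
        ; comm-ind = λ H I p x → Φ.trans Ω H
                       (GroupHomomorphism.⟦⟧-cong (hom g H) (comm-ind f H I p x)) (comm-ind g H I p _)
        ; comm-con = λ h H x → Φ.trans Ω (conj h H)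
                       (GroupHomomorphism.⟦⟧-cong (hom g (conj h H)) (comm-con f h H x))
                       (comm-con g h H _) }
    ; equiv     = λ {Φ} {Ψ} → record
        { refl  = λ H _ → Φ.refl Ψ H
        ; sym   = λ p H x → Φ.sym Ψ H (p H x)
        ; trans = λ p q H x → Φ.trans Ψ H (p H x) (q H x) }
    ; ∘-resp-≈  = λ {_} {_} {Ω} {f} p q H x → Φ.trans Ω H
                    (GroupHomomorphism.⟦⟧-cong (hom f H) (q H x)) (p H _)
    ; assoc     = λ {_} {_} {_} {Ω} H _ → Φ.refl Ω H
    ; identityˡ = λ {_} {Ψ} H _ → Φ.refl Ψ H
    ; identityʳ = λ {_} {Ψ} H _ → Φ.refl Ψ H
    }
    where
    open MackeyHom
    module Φ (Ψ : MackeyFunctor) (H : OpenSubgroup) = AbelianGroup (MackeyFunctor.Φ Ψ H)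

  module _ (Ψ : MackeyFunctor) where
    open MackeyFunctor Ψ

    module _ (H U : OpenSubgroup) (U-normal : IsNormal U) where
      private
        module U = Φ U
        cong-res : ∀ {I K} (p : I ≤ K) {x y} → Φ._≈_ K x y →
                   Φ._≈_ I (⟦ res I K p ⟧ x) (⟦ res I K p ⟧ y)
        cong-res p = GroupHomomorphism.⟦⟧-cong (res _ _ p)
        cong-con : ∀ g {K} {x y} → Φ._≈_ K x y →
                   Φ._≈_ (conj g K) (⟦ con g K ⟧ x) (⟦ con g K ⟧ y)
        cong-con g = GroupHomomorphism.⟦⟧-cong (con g _)

        to-U : ∀ g → U ≤ conj g U
        to-U g = proj₂ (normal-conj g {U} U-normal)

        act : G.Carrier → U.Carrier → U.Carrier
        act g x = coe {conj g U} {U} (normal-conj g {U} U-normal) (⟦ con g U ⟧ x)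

        act-∙ : ∀ g x y → act g (x U.∙ y) U.≈ act g x U.∙ act g y
        act-∙ g x y = U.trans
          (cong-res {U} {conj g U} (to-U g) (GroupHomomorphism.homo (con g U) x y))
          (GroupHomomorphism.homo (res U (conj g U) (to-U g)) _ _)

        act-≈ : ∀ {g g′} → g G.≈ g′ → ∀ x → act g x U.≈ act g′ x
        act-≈ {g} {g′} e x = U.trans
          (U.sym (res-res U (conj g′ U) (conj g U) (to-U g′) (proj₂ (conj-cong U e)) (to-U g) _))
          (cong-res {U} {conj g′ U} (to-U g′) (con-cong U e x))

        act-assoc : ∀ g h x → act (g G.∙ h) x U.≈ act g (act h x)
        act-assoc g h x = begin
          act (g G.∙ h) x
            ≈⟨ cong-res {U} {conj (g G.∙ h) U} (to-U (g G.∙ h)) (con-con g h U x) ⟨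
          ⟦ res U (conj (g G.∙ h) U) (to-U (g G.∙ h)) ⟧
            (⟦ res (conj (g G.∙ h) U) (conj g (conj h U)) (proj₂ (conj-comp g h U)) ⟧ y)
            ≈⟨ res-res U (conj (g G.∙ h) U) (conj g (conj h U)) (to-U (g G.∙ h))
                 (proj₂ (conj-comp g h U)) through y ⟩
          ⟦ res U (conj g (conj h U)) through ⟧ y
            ≈⟨ res-res U (conj g U) (conj g (conj h U)) (to-U g) (to-U h) through y ⟨
          ⟦ res U (conj g U) (to-U g) ⟧ (⟦ res (conj g U) (conj g (conj h U)) (to-U h) ⟧ y)
            ≈⟨ cong-res {U} {conj g U} (to-U g) (con-res g U (conj h U) (to-U h) (⟦ con h U ⟧ x)) ⟨
          act g (act h x) ∎
          where
          open SetoidReasoning U.setoid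
          y : Φ.Carrier (conj g (conj h U))
          y = ⟦ con g (conj h U) ⟧ (⟦ con h U ⟧ x)
          through : U ≤ conj g (conj h U)
          through u = to-U h (to-U g u)

        act-U : ∀ {u} → u ∈ₒ U → ∀ x → act u x U.≈ x
        act-U {u} u∈ x = U.trans (cong-res {U} {conj u U} (to-U u) (con-id U u∈ x))
          (U.trans (res-res U (conj u U) U (to-U u) (proj₂ (conj-self U u∈)) (λ v → v) x)
                   (res-id U (λ v → v) x))

        act-cong : ∀ {g g′ x y} → (g G.⁻¹) G.∙ g′ ∈ₒ U → x U.≈ y → act g x U.≈ act g′ y
        act-cong {g} {g′} {x} {y} p x≈y = begin
          act g x                     ≈⟨ act-x≈y x≈y ⟩
          act g y                     ≈⟨ act-x≈y (act-U p y) ⟨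
          act g (act (g G.⁻¹ G.∙ g′) y) ≈⟨ act-assoc g _ y ⟨
          act (g G.∙ (g G.⁻¹ G.∙ g′)) y ≈⟨ act-≈ (\\-leftDividesˡ g g′) y ⟩
          act g′ y                    ∎
          where
          open SetoidReasoning U.setoid
          open GroupProperties G.group using (\\-leftDividesˡ)
          act-x≈y : ∀ {x y} → x U.≈ y → act g x U.≈ act g y
          act-x≈y e = cong-res {U} {conj g U} (to-U g) (cong-con g {U} e)

      conAction : Action (Quotient H U U-normal) (Φ U)
      conAction = record
        { _·_     = λ (h , _) → act h
        ; ·-cong  = act-cong
        ; ·-ε     = act-U (OpenSubgroup.ε-closed U)
        ; ·-assoc = λ (g , _) (h , _) → act-assoc g h
        ; ·-∙     = λ (h , _) → act-∙ h
        }

      private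
        res-invariant : (U≤H : U ≤ H) → ∀ x {h} → h ∈ₒ H →
                        act h (⟦ res U H U≤H ⟧ x) U.≈ ⟦ res U H U≤H ⟧ x
        res-invariant U≤H x {h} h∈ = begin
          act h (⟦ res U H U≤H ⟧ x)
            ≈⟨ cong-res {U} {conj h U} (to-U h) (con-res h U H U≤H x) ⟩
          ⟦ res U (conj h U) (to-U h) ⟧ (⟦ res (conj h U) (conj h H) U≤H ⟧ (⟦ con h H ⟧ x))
            ≈⟨ res-res U (conj h U) (conj h H) (to-U h) U≤H U≤hH _ ⟩
          ⟦ res U (conj h H) U≤hH ⟧ (⟦ con h H ⟧ x)
            ≈⟨ cong-res {U} {conj h H} U≤hH (con-id H h∈ x) ⟩
          ⟦ res U (conj h H) U≤hH ⟧ (⟦ res (conj h H) H (proj₂ (conj-self H h∈)) ⟧ x)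
            ≈⟨ res-res U (conj h H) H U≤hH (proj₂ (conj-self H h∈)) U≤H x ⟩
          ⟦ res U H U≤H ⟧ x ∎
          where
          open SetoidReasoning U.setoid
          U≤hH : U ≤ conj h H
          U≤hH u = U≤H (to-U h u)

      resInvariants : U ≤ H → Φ.Carrier H → AbelianGroup.Carrier (Action.Invariants conAction)
      resInvariants U≤H x = ⟦ res U H U≤H ⟧ x , λ (h , h∈) → res-invariant U≤H x h∈

    HasGaloisDescent : Set (suc ℓ)
    HasGaloisDescent = ∀ H U (U-normal : IsNormal U) (U≤H : U ≤ H) →
      GroupMorphisms.IsGroupIsomorphism (Φ.rawGroup H)
        (AbelianGroup.rawGroup (Action.Invariants (conAction H U U-normal)))
        (resInvariants H U U-normal U≤H)

  MackGal : Category (suc ℓ) (suc ℓ) (suc ℓ)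
  MackGal = FullSubcategory Mack HasGaloisDescent

{-# OPTIONS --safe #-}
module Submission where

-- A discrete module M gives the Mackey functor H ↦ M^H with inclusions as restrictions and
-- traces over H/I as inductions.  Conversely a Mackey functor Φ with descent gives the
-- colimit of Φ(U) over the normal open subgroups U, with G acting through con.  Every
-- stabiliser in M is open, so it contains a normal open subgroup (open subgroups have finite
-- index by compactness) and M is the colimit of the M^U.  Descent makes Φ(H) → (colim Φ)^H,
-- x ↦ [res_{U,H} x], bijective; it respects inductions because for normal U ≤ I the Mackey
-- formula reads res_{U,H} ind_{H,I} = ∑_{c ∈ H/I} c · res_{U,I}.

open import Algebra.Bundles using (Group; AbelianGroup)
open import Algebra.Morphism.Bundles using (GroupHomomorphism)
open import Algebra.Morphism.Structures using (module GroupMorphisms)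
import Algebra.Properties.CommutativeSemigroup as CommutativeSemigroupProperties
import Algebra.Properties.Group as GroupProperties
open import Axiom.ExcludedMiddle using (ExcludedMiddle)
open import Data.Bool.Base using (Bool; T)
open import Data.List.Base using (List; []; _∷_; _++_; map; concatMap; foldr)
open import Data.List.Relation.Unary.All as All using (All; []; _∷_)
import Data.List.Relation.Unary.All.Properties as All
open import Data.List.Relation.Unary.AllPairs as AllPairs using (AllPairs; []; _∷_)
import Data.List.Relation.Unary.AllPairs.Properties as AllPairs
open import Data.List.Relation.Unary.Any as Any using (Any; here; there; _─_)
import Data.List.Relation.Unary.Any.Properties as Any
open import Data.Product.Base using (∃-syntax; _×_; _,_; proj₁; proj₂)
open import Data.Unit.Polymorphic.Base using (tt)
open import Level using (Level; Lift; lift; lower; suc)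
open import Relation.Binary.Core using (Rel)
open import Relation.Binary.Structures using (IsEquivalence)
import Relation.Binary.Reasoning.Setoid as SetoidReasoning
open import Relation.Nullary.Decidable
  using (Dec; yes; no; map′; True; toWitness; fromWitness; ⌊_⌋)
open import Relation.Nullary.Negation using (¬_; contradiction)
open import Defs

-- Finite sums

-- Induction on fixed points needs a list of coset representatives, and nothing canonical picks one.
-- Its laws therefore become statements about lists: translates, conjugates and products of
-- transversals are again transversals, and a sum over a transversal does not depend on the choice.
-- The Mackey formula, for instance, says that two lists both represent H/J.
--
-- Excluded middle enters in two ways. It thins the finite cover given by compactness to a
-- transversal, and it makes the colimit small: open subgroups form a type one universe above the
-- groups Φ(H), so the colimit runs over Boolean characteristic functions instead.
--
-- Descent is already used to build the colimit, since equality of germs is tested on one fixed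
-- intersection.

module _ {ℓ} (A : AbelianGroup ℓ ℓ) where
  open AbelianGroup A
  open CommutativeSemigroupProperties commutativeSemigroup using (interchange; x∙yz≈y∙xz)
  open SetoidReasoning setoid

  module _ {X : Set ℓ} where

    ∑-cong : ∀ (xs : List X) {f g} → (∀ x → f x ≈ g x) → ∑ A xs f ≈ ∑ A xs g
    ∑-cong []       e = refl
    ∑-cong (x ∷ xs) e = ∙-cong (e x) (∑-cong xs e)

    ∑-∙ : ∀ (xs : List X) f g → ∑ A xs (λ x → f x ∙ g x) ≈ ∑ A xs f ∙ ∑ A xs g
    ∑-∙ []       f g = sym (identityˡ ε)
    ∑-∙ (x ∷ xs) f g = trans (∙-congˡ (∑-∙ xs f g)) (interchange _ _ _ _)

    ∑-++ : ∀ (xs ys : List X) f → ∑ A (xs ++ ys) f ≈ ∑ A xs f ∙ ∑ A ys f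
    ∑-++ []       ys f = sym (identityˡ _)
    ∑-++ (x ∷ xs) ys f = trans (∙-congˡ (∑-++ xs ys f)) (sym (assoc _ _ _))

  module _ {X Y : Set ℓ} where

    ∑-map : ∀ (k : X → Y) xs f → ∑ A (map k xs) f ≈ ∑ A xs (λ x → f (k x))
    ∑-map k []       f = refl
    ∑-map k (x ∷ xs) f = ∙-congˡ (∑-map k xs f)

    ∑-concatMap : ∀ (T : X → List Y) xs f → ∑ A (concatMap T xs) f ≈ ∑ A xs (λ x → ∑ A (T x) f)
    ∑-concatMap T []       f = refl
    ∑-concatMap T (x ∷ xs) f = trans (∑-++ (T x) _ f) (∙-congˡ (∑-concatMap T xs f))

  module _ {X : Set ℓ} {_∼_ : Rel X ℓ} (∼-equiv : IsEquivalence _∼_)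
           {f : X → Carrier} (f-resp : ∀ {x y} → x ∼ y → f x ≈ f y) where
    private module ∼ = IsEquivalence ∼-equiv

    private
      _≁_ : Rel X ℓ
      x ≁ y = ¬ x ∼ y

      ∑-─ : ∀ {x} ys (p : Any (_∼ x) ys) → ∑ A ys f ≈ f x ∙ ∑ A (ys ─ p) f
      ∑-─ (y ∷ ys) (here y∼x) = ∙-congʳ (f-resp y∼x)
      ∑-─ (y ∷ ys) (there p)  = trans (∙-congˡ (∑-─ ys p)) (x∙yz≈y∙xz _ _ _)

      AllPairs-─ : ∀ {x ys} (p : Any (_∼ x) ys) → AllPairs _≁_ ys → AllPairs _≁_ (ys ─ p)
      AllPairs-─ (here _)  (_ ∷ ≁s)  = ≁s
      AllPairs-─ (there p) (≁ ∷ ≁s) = All.─⁺ p ≁ ∷ AllPairs-─ p ≁s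

      ≁-─ : ∀ {x ys} (p : Any (_∼ x) ys) → AllPairs _≁_ ys → All (x ≁_) (ys ─ p)
      ≁-─ (here y∼x) (≁ ∷ _)  = All.map (λ y≁z x∼z → y≁z (∼.trans y∼x x∼z)) ≁
      ≁-─ (there p)  (≁ ∷ ≁s) =
        (λ x∼y → let (_ , y≁z , z∼x) = found p ≁ in y≁z (∼.sym (∼.trans z∼x x∼y))) ∷ ≁-─ p ≁s
        where
        found : ∀ {P Q : X → Set ℓ} {ys} → Any P ys → All Q ys → ∃[ z ] Q z × P z
        found (here p)  (q ∷ _)  = _ , q , p
        found (there p) (_ ∷ qs) = found p qs

      Any-─ : ∀ {x z ys} (p : Any (_∼ x) ys) → x ≁ z → Any (_∼ z) ys → Any (_∼ z) (ys ─ p)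
      Any-─ (here y∼x) x≁z (here y∼z) = contradiction (∼.trans (∼.sym y∼x) y∼z) x≁z
      Any-─ (here _)   x≁z (there q)  = q
      Any-─ (there p)  x≁z (here y∼z) = here y∼z
      Any-─ (there p)  x≁z (there q)  = there (Any-─ p x≁z q)

      drop : ∀ {x z xs} → x ≁ z → Any (_∼ z) (x ∷ xs) → Any (_∼ z) xs
      drop x≁z (here x∼z) = contradiction x∼z x≁z
      drop x≁z (there q)  = q

    -- Induction on `xs`: the head x has a partner in `ys`, which contributes the same summand and
    -- is deleted. What is left of `ys` is inequivalent to x, so its partners lie in the tail of
    -- `xs`, and the hypotheses survive.
    ∑-transversal : ∀ xs ys → AllPairs _≁_ xs → AllPairs _≁_ ys →
                    All (λ x → Any (_∼ x) ys) xs → All (λ y → Any (_∼ y) xs) ys →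
                    ∑ A xs f ≈ ∑ A ys f
    ∑-transversal []       []       _         _   _           _         = refl
    ∑-transversal []       (_ ∷ _)  _         _   _           (() ∷ _)
    ∑-transversal (x ∷ xs) ys       (≁ ∷ ≁xs) ≁ys (p ∷ xs⊆ys) ys⊆xs = begin
      f x ∙ ∑ A xs f       ≈⟨ ∙-congˡ (∑-transversal xs (ys ─ p) ≁xs (AllPairs-─ p ≁ys)
                                (All.zipWith (λ (x≁z , q) → Any-─ p x≁z q) (≁ , xs⊆ys))
                                (All.zipWith (λ (x≁z , q) → drop x≁z q)
                                  (≁-─ p ≁ys , All.─⁺ p ys⊆xs))) ⟩
      f x ∙ ∑ A (ys ─ p) f ≈⟨ ∑-─ ys p ⟨
      ∑ A ys f             ∎

hom-∑ : ∀ {ℓ} (A B : AbelianGroup ℓ ℓ) (φ : A →ᴬ B) {X : Set ℓ} (xs : List X) f →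
        AbelianGroup._≈_ B (⟦ φ ⟧ (∑ A xs f)) (∑ B xs (λ x → ⟦ φ ⟧ (f x)))
hom-∑ A B φ []       f = GroupHomomorphism.ε-homo φ
hom-∑ A B φ (x ∷ xs) f = B.trans (GroupHomomorphism.homo φ _ _) (B.∙-congˡ (hom-∑ A B φ xs f))
  where module B = AbelianGroup B

module _ {ℓ} (G : ProfiniteGroup ℓ) where
  open ProfiniteGroup G
  open OpenSubgroups G
  open GroupProperties group
    using (\\-leftDividesˡ; \\-leftDividesʳ; //-rightDividesˡ; //-rightDividesʳ; ⁻¹-involutive; ∙-cancelˡ)
  open SetoidReasoning setoid
  private module S = OpenSubgroup

  -- Left cosets

  infix 4 _∼⟨_⟩_

  -- Equality of the cosets cI and dI, with the connecting element as witness. This is the one-sided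
  -- form of the relation in `DoubleCosetRepresentatives`, so witnesses can be passed between the
  -- two.
  _∼⟨_⟩_ : Carrier → OpenSubgroup → Carrier → Set ℓ
  c ∼⟨ I ⟩ d = ∃[ i ] i ∈ₒ I × d ≈ c ∙ i

  ∼-isEquivalence : ∀ I → IsEquivalence (_∼⟨ I ⟩_)
  ∼-isEquivalence I = record
    { refl  = ε , I.ε-closed , sym (identityʳ _)
    ; sym   = λ (i , i∈ , d≈ci) →
                i ⁻¹ , I.⁻¹-closed i∈ , trans (sym (//-rightDividesʳ i _)) (∙-congʳ (sym d≈ci))
    ; trans = λ (i , i∈ , d≈ci) (j , j∈ , e≈dj) →
                i ∙ j , I.∙-closed i∈ j∈ , trans e≈dj (trans (∙-congʳ d≈ci) (assoc _ i j))
    }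
    where module I = OpenSubgroup I

  conj-slide : ∀ g k → g ∙ (g ⁻¹ ∙ k ∙ g) ≈ k ∙ g
  conj-slide g k = trans (sym (assoc g _ g)) (∙-congʳ (\\-leftDividesˡ g k))

  conj-∙ : ∀ g c i → g ∙ (c ∙ i) ∙ g ⁻¹ ≈ (g ∙ c ∙ g ⁻¹) ∙ (g ∙ i ∙ g ⁻¹)
  conj-∙ g c i = begin
    g ∙ (c ∙ i) ∙ g ⁻¹                   ≈⟨ ∙-congʳ (assoc g c i) ⟨
    g ∙ c ∙ i ∙ g ⁻¹                     ≈⟨ assoc (g ∙ c) i _ ⟩
    g ∙ c ∙ (i ∙ g ⁻¹)                   ≈⟨ ∙-congˡ (\\-leftDividesʳ g _) ⟨
    g ∙ c ∙ (g ⁻¹ ∙ (g ∙ (i ∙ g ⁻¹)))    ≈⟨ assoc (g ∙ c) _ _ ⟨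
    (g ∙ c ∙ g ⁻¹) ∙ (g ∙ (i ∙ g ⁻¹))    ≈⟨ ∙-congˡ (assoc g i _) ⟨
    (g ∙ c ∙ g ⁻¹) ∙ (g ∙ i ∙ g ⁻¹)      ∎

  conj-undo : ∀ g c → g ⁻¹ ∙ (g ∙ c ∙ g ⁻¹) ∙ g ≈ c
  conj-undo g c = begin
    g ⁻¹ ∙ (g ∙ c ∙ g ⁻¹) ∙ g   ≈⟨ assoc _ _ g ⟩
    g ⁻¹ ∙ (g ∙ c ∙ g ⁻¹ ∙ g)   ≈⟨ ∙-congˡ (//-rightDividesˡ g _) ⟩
    g ⁻¹ ∙ (g ∙ c)              ≈⟨ \\-leftDividesʳ g c ⟩
    c                           ∎

  conj-redo : ∀ g x → g ∙ (g ⁻¹ ∙ x ∙ g) ∙ g ⁻¹ ≈ x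
  conj-redo g x = trans (∙-congʳ (conj-slide g x)) (//-rightDividesʳ g x)

  record Transversal (H I : OpenSubgroup) (cs : List Carrier) : Set ℓ where
    field
      inH      : All (_∈ₒ H) cs
      covers   : ∀ {x} → x ∈ₒ H → Any (_∼⟨ I ⟩ x) cs
      distinct : AllPairs (λ c d → ¬ c ∼⟨ I ⟩ d) cs

  module _ {H I : OpenSubgroup} where

    translate : ∀ {cs h} → h ∈ₒ H → Transversal H I cs → Transversal H I (map (h ∙_) cs)
    translate {cs} {h} h∈ t = record
      { inH      = All.map⁺ (All.map (S.∙-closed H h∈) inH)
      ; covers   = λ x∈ → Any.map⁺ (Any.map
                     (λ (i , i∈ , e) → i , i∈ ,
                       trans (sym (\\-leftDividesˡ h _)) (trans (∙-congˡ e) (sym (assoc h _ i))))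
                     (covers (S.∙-closed H (S.⁻¹-closed H h∈) x∈)))
      ; distinct = AllPairs.map⁺ (AllPairs.map
                     (λ c≁d (i , i∈ , e) → c≁d (i , i∈ , ∙-cancelˡ h _ _ (trans e (assoc h _ i))))
                     distinct)
      }
      where open Transversal t

    conjugate : ∀ g {cs} → Transversal H I cs →
                Transversal (conj g H) (conj g I) (map (λ c → g ∙ c ∙ g ⁻¹) cs)
    conjugate g t = record
      { inH      = All.map⁺ (All.map (S.resp H (sym (conj-undo g _))) inH)
      ; covers   = λ {x} x∈ → Any.map⁺ (Any.map
                     (λ (i , i∈ , e) → g ∙ i ∙ g ⁻¹ , S.resp I (sym (conj-undo g i)) i∈ ,
                       trans (sym (conj-redo g x)) (trans (∙-congʳ (∙-congˡ e)) (conj-∙ g _ i)))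
                     (covers x∈))
      ; distinct = AllPairs.map⁺ (AllPairs.map
                     (λ {c} {d} c≁d (k , k∈ , e) → c≁d (g ⁻¹ ∙ k ∙ g , k∈ , (begin
                       d                                       ≈⟨ conj-undo g d ⟨
                       g ⁻¹ ∙ (g ∙ d ∙ g ⁻¹) ∙ g               ≈⟨ ∙-congʳ (∙-congˡ e) ⟩
                       g ⁻¹ ∙ (g ∙ c ∙ g ⁻¹ ∙ k) ∙ g           ≈⟨ ∙-congʳ (∙-congˡ (∙-congˡ (conj-redo g k))) ⟨
                       g ⁻¹ ∙ (g ∙ c ∙ g ⁻¹ ∙ (g ∙ (g ⁻¹ ∙ k ∙ g) ∙ g ⁻¹)) ∙ g
                                                               ≈⟨ ∙-congʳ (∙-congˡ (conj-∙ g c _)) ⟨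
                       g ⁻¹ ∙ (g ∙ (c ∙ (g ⁻¹ ∙ k ∙ g)) ∙ g ⁻¹) ∙ g
                                                               ≈⟨ conj-undo g _ ⟩
                       c ∙ (g ⁻¹ ∙ k ∙ g)                      ∎)))
                     distinct)
      }
      where open Transversal t

  singleton : ∀ {H I} → H ≤ I → Transversal H I (ε ∷ [])
  singleton {H} H≤I = record
    { inH      = S.ε-closed H ∷ []
    ; covers   = λ x∈ → here (_ , H≤I x∈ , sym (identityˡ _))
    ; distinct = [] ∷ []
    }

  -- The common pattern of `tower` and `double-coset-refine`: H is cut into blocks indexed by `hs`,
  -- and each block into left cosets of J. `R` is whatever keeps two blocks apart: inequivalence of
  -- cosets in one case, of double cosets in the other.
  refine : ∀ {H J hs} (R : Rel Carrier ℓ) (T : Carrier → List Carrier) →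
           All (λ h → All (_∈ₒ H) (T h)) hs →
           (∀ {x} → x ∈ₒ H → Any (λ h → Any (_∼⟨ J ⟩ x) (T h)) hs) →
           (∀ h → AllPairs (λ c d → ¬ c ∼⟨ J ⟩ d) (T h)) →
           AllPairs R hs →
           (∀ {h h′} → R h h′ → All (λ c → All (λ d → ¬ c ∼⟨ J ⟩ d) (T h′)) (T h)) →
           Transversal H J (concatMap T hs)
  refine R T inH covers distinct Rs separated = record
    { inH      = All.concat⁺ (All.map⁺ inH)
    ; covers   = λ x∈ → Any.concatMap⁺ T (covers x∈)
    ; distinct = AllPairs.concat⁺ (All.map⁺ (All.universal distinct _))
                   (AllPairs.map⁺ (AllPairs.map separated Rs))
    }

  private
    pairwise : ∀ {P : Carrier → Set ℓ} {Q : Rel Carrier ℓ} {xs ys} →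
               (∀ {x y} → P x → P y → Q x y) → All P xs → All P ys → All (λ x → All (Q x) ys) xs
    pairwise f ps qs = All.map (λ p → All.map (f p) qs) ps

  tower : ∀ {H I J cs ds} → I ≤ H → J ≤ I → Transversal H I cs → Transversal I J ds →
          Transversal H J (concatMap (λ c → map (c ∙_) ds) cs)
  tower {H} {I} {J} I≤H J≤I s t = refine _ _
    (All.map (λ c∈ → All.map⁺ (All.map (λ d∈ → S.∙-closed H c∈ (I≤H d∈)) t.inH)) s.inH)
    (λ x∈ → Any.map
      (λ (i , i∈ , e) → Any.map⁺ (Any.map
        (λ (j , j∈ , e′) → j , j∈ , trans e (trans (∙-congˡ e′) (sym (assoc _ _ j))))
        (t.covers i∈)))
      (s.covers x∈))
    (λ c → AllPairs.map⁺ (AllPairs.map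
      (λ d≁d′ (j , j∈ , e) → d≁d′ (j , j∈ , ∙-cancelˡ c _ _ (trans e (assoc c _ j))))
      t.distinct))
    s.distinct
    (λ {c} {c′} c≁c′ → All.map⁺ (All.map (λ {d} → All.map⁺) (pairwise
      (λ {d} {d′} d∈ d′∈ (j , j∈ , e) → c≁c′
        ( d ∙ j ∙ d′ ⁻¹
        , S.∙-closed I (S.∙-closed I d∈ (J≤I j∈)) (S.⁻¹-closed I d′∈)
        , (begin
            c′                      ≈⟨ //-rightDividesʳ d′ c′ ⟨
            c′ ∙ d′ ∙ d′ ⁻¹         ≈⟨ ∙-congʳ e ⟩
            c ∙ d ∙ j ∙ d′ ⁻¹       ≈⟨ ∙-congʳ (assoc c d j) ⟩
            c ∙ (d ∙ j) ∙ d′ ⁻¹     ≈⟨ assoc c _ _ ⟩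
            c ∙ (d ∙ j ∙ d′ ⁻¹)     ∎)))
      t.inH t.inH)))
    where
    module s = Transversal s
    module t = Transversal t

  -- Orbit decomposition of H/J under left multiplication by I: the stabiliser of hJ in I is I ∩
  -- hJh⁻¹, so its orbit consists of the cosets thJ with t in a transversal of that stabiliser. This
  -- is the combinatorial content of the Mackey formula.
  double-coset-refine : ∀ {I J H hs} (T : Carrier → List Carrier) → I ≤ H →
    DoubleCosetRepresentatives I H J hs → (∀ h → Transversal I (I ∩ₒ conj h J) (T h)) →
    Transversal H J (concatMap (λ h → map (_∙ h) (T h)) hs)
  double-coset-refine {I} {J} {H} T I≤H d t = refine (λ h h′ → ¬ h ∼ h′) _
    (All.map (λ {h} h∈ → All.map⁺ (All.map (λ t∈ → S.∙-closed H (I≤H t∈) h∈) (t.inH h))) d.inH)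
    (λ {x} x∈ → Any.map
      (λ {h} (i , j , i∈ , j∈ , e) → Any.map⁺ (Any.map
        (λ {c} (k , (k∈I , k∈hJ) , e′) → (h ⁻¹ ∙ k ∙ h) ∙ j , S.∙-closed J k∈hJ j∈ , (begin
          x                               ≈⟨ e ⟩
          i ∙ h ∙ j                       ≈⟨ ∙-congʳ (∙-congʳ e′) ⟩
          c ∙ k ∙ h ∙ j                   ≈⟨ ∙-congʳ (slide c h k) ⟨
          c ∙ h ∙ (h ⁻¹ ∙ k ∙ h) ∙ j      ≈⟨ assoc _ _ j ⟩
          c ∙ h ∙ ((h ⁻¹ ∙ k ∙ h) ∙ j)    ∎))
        (t.covers h i∈)))
      (d.covers x∈))
    (λ h → AllPairs.map⁺ (within h (t.inH h) (t.distinct h)))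
    d.distinct
    (λ {h} {h′} h≁h′ → All.map⁺ (All.map (λ {c} c∈ → All.map⁺ (All.map
      (λ {c′} c′∈ (j , j∈ , e) → h≁h′
        ( c′ ⁻¹ ∙ c , j , S.∙-closed I (S.⁻¹-closed I c′∈) c∈ , j∈
        , (begin
            h′                      ≈⟨ \\-leftDividesʳ c′ h′ ⟨
            c′ ⁻¹ ∙ (c′ ∙ h′)       ≈⟨ ∙-congˡ e ⟩
            c′ ⁻¹ ∙ (c ∙ h ∙ j)     ≈⟨ assoc _ _ j ⟨
            c′ ⁻¹ ∙ (c ∙ h) ∙ j     ≈⟨ ∙-congʳ (assoc _ c h) ⟨
            c′ ⁻¹ ∙ c ∙ h ∙ j       ∎)))
      (t.inH h′))) (t.inH h)))
    where
    module d = DoubleCosetRepresentatives d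
    module t h = Transversal (t h)
    open d using (_∼_)

    slide : ∀ c h k → c ∙ h ∙ (h ⁻¹ ∙ k ∙ h) ≈ c ∙ k ∙ h
    slide c h k = begin
      c ∙ h ∙ (h ⁻¹ ∙ k ∙ h)   ≈⟨ assoc c h _ ⟩
      c ∙ (h ∙ (h ⁻¹ ∙ k ∙ h)) ≈⟨ ∙-congˡ (conj-slide h k) ⟩
      c ∙ (k ∙ h)              ≈⟨ assoc c k h ⟨
      c ∙ k ∙ h                ∎

    -- If c′h = chj, then c⁻¹c′ = hjh⁻¹ lies in hJh⁻¹, but it lies in I only because c and c′ do. So
    -- membership in I is carried along the recursion.
    within : ∀ h {cs} → All (_∈ₒ I) cs → AllPairs (λ c c′ → ¬ c ∼⟨ I ∩ₒ conj h J ⟩ c′) cs →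
             AllPairs (λ c c′ → ¬ (c ∙ h) ∼⟨ J ⟩ (c′ ∙ h)) cs
    within h []        []          = []
    within h (c∈ ∷ cs∈) (≁ ∷ ≁s) = All.zipWith separate (cs∈ , ≁) ∷ within h cs∈ ≁s
      where
      separate : ∀ {c′} → c′ ∈ₒ I × (¬ _ ∼⟨ I ∩ₒ conj h J ⟩ c′) → ¬ (_ ∙ h) ∼⟨ J ⟩ (c′ ∙ h)
      separate {c′} (c′∈ , c≁c′) (j , j∈ , e) = c≁c′
        ( _ ⁻¹ ∙ c′
        , (S.∙-closed I (S.⁻¹-closed I c∈) c′∈ , S.resp J (sym eq) j∈)
        , sym (\\-leftDividesˡ _ c′))
        where
        eq : h ⁻¹ ∙ (_ ⁻¹ ∙ c′) ∙ h ≈ j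
        eq = begin
          h ⁻¹ ∙ (_ ⁻¹ ∙ c′) ∙ h     ≈⟨ assoc _ _ h ⟩
          h ⁻¹ ∙ (_ ⁻¹ ∙ c′ ∙ h)     ≈⟨ ∙-congˡ (assoc _ c′ h) ⟩
          h ⁻¹ ∙ (_ ⁻¹ ∙ (c′ ∙ h))   ≈⟨ ∙-congˡ (∙-congˡ e) ⟩
          h ⁻¹ ∙ (_ ⁻¹ ∙ (_ ∙ h ∙ j)) ≈⟨ ∙-congˡ (∙-congˡ (assoc _ h j)) ⟩
          h ⁻¹ ∙ (_ ⁻¹ ∙ (_ ∙ (h ∙ j))) ≈⟨ ∙-congˡ (\\-leftDividesʳ _ _) ⟩
          h ⁻¹ ∙ (h ∙ j)             ≈⟨ \\-leftDividesʳ h j ⟩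
          j                          ∎

  -- For U normal, U\H/I = H/I.
  normal-double-cosets : ∀ {U H I cs} → IsNormal U → U ≤ I → Transversal H I cs →
                         DoubleCosetRepresentatives U H I cs
  normal-double-cosets {U} {H} {I} n U≤I t = record
    { inH      = inH
    ; covers   = λ x∈ → Any.map
                   (λ (i , i∈ , e) → ε , i , S.ε-closed U , i∈ , trans e (∙-congʳ (sym (identityˡ _))))
                   (covers x∈)
    ; distinct = AllPairs.map
                   (λ {c} c≁d (u , i , u∈ , i∈ , e) → c≁d
                     ( c ⁻¹ ∙ u ∙ c ∙ i
                     , S.∙-closed I (U≤I (proj₂ (normal-conj c {U} n) u∈)) i∈
                     , trans e (trans (∙-congʳ (sym (conj-slide c u))) (assoc c _ i))))
                   distinct
    }
    where open Transversal t

  -- Open cosets and normal open subgroups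

  coset : Carrier → OpenSubgroup → Subset setoid
  coset g H = record
    { member = λ x → g ⁻¹ ∙ x ∈ₒ H
    ; resp   = λ e → S.resp H (∙-congˡ e) }

  -- Continuity of multiplication puts around every (g⁻¹, x) with g⁻¹x in H a box that multiplies
  -- into H. The second factors of these boxes, taken over all such x, have the coset as their
  -- union.
  coset-open : ∀ g H → IsOpen (coset g H)
  coset-open g H = open-resp {⋃ V} {coset g H}
    (λ ((_ , x∈) , y∈) → let (_ , _ , _ , _ , g∈ , _ , box) = nbhd x∈ in box g∈ y∈)
    (λ {x} x∈ → (x , x∈) , (let (_ , _ , _ , _ , _ , x∈V , _) = nbhd x∈ in x∈V))
    (open-⋃ V (λ (_ , x∈) → let (_ , _ , _ , oV , _) = nbhd x∈ in oV))
    where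
    nbhd : ∀ {x} → g ⁻¹ ∙ x ∈ₒ H → _
    nbhd {x} = ∙-continuous (S.subset H) (S.isOpen H) {g ⁻¹} {x}
    V : (∃[ x ] g ⁻¹ ∙ x ∈ₒ H) → Subset setoid
    V (_ , x∈) = proj₁ (proj₂ (nbhd x∈))

  whole : OpenSubgroup
  whole = record
    { subset = full ; isOpen = open-full ; ε-closed = tt
    ; ∙-closed = λ _ _ → tt ; ⁻¹-closed = λ _ → tt }

  ∩-normal : ∀ {U V} → IsNormal U → IsNormal V → IsNormal (U ∩ₒ V)
  ∩-normal m n g (u , v) = m g u , n g v

  -- Inverting morphisms of Mackey functors

  module _ {Φ Ψ : MackeyFunctor G} (f : MackeyHom G Φ Ψ) where
    private
      module Φ = MackeyFunctor Φ
      module Ψ = MackeyFunctor Ψ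
      module f = MackeyHom f

    -- Every law for the inverse holds after applying f, and f reflects equality.
    inverseHom : (∀ H {x y} → Ψ.Φ._≈_ H (⟦ f.hom H ⟧ x) (⟦ f.hom H ⟧ y) → Φ.Φ._≈_ H x y) →
                 (∀ H y → ∃[ x ] Ψ.Φ._≈_ H (⟦ f.hom H ⟧ x) y) → MackeyHom G Ψ Φ
    inverseHom injective surjective = record
      { hom      = λ H → mkHom {A = Ψ.Φ H} {B = Φ.Φ H} (g H)
          (λ {x} {y} e → injective H (Ψ.Φ.trans H (fg H x) (Ψ.Φ.trans H e (Ψ.Φ.sym H (fg H y)))))
          (λ x y → injective H (Ψ.Φ.trans H (fg H _) (Ψ.Φ.sym H (Ψ.Φ.trans H
            (GroupHomomorphism.homo (f.hom H) _ _) (Ψ.Φ.∙-cong H (fg H x) (fg H y))))))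
      ; comm-res = λ I H p y → injective I (Ψ.Φ.trans I (fg I _) (Ψ.Φ.sym I (Ψ.Φ.trans I
          (f.comm-res I H p _) (GroupHomomorphism.⟦⟧-cong (Ψ.res I H p) (fg H y)))))
      ; comm-ind = λ H I p y → injective H (Ψ.Φ.trans H (fg H _) (Ψ.Φ.sym H (Ψ.Φ.trans H
          (f.comm-ind H I p _) (GroupHomomorphism.⟦⟧-cong (Ψ.ind H I p) (fg I y)))))
      ; comm-con = λ c H y → injective (conj c H) (Ψ.Φ.trans (conj c H) (fg (conj c H) _)
          (Ψ.Φ.sym (conj c H) (Ψ.Φ.trans (conj c H)
            (f.comm-con c H _) (GroupHomomorphism.⟦⟧-cong (Ψ.con c H) (fg H y)))))
      }
      where
      g : ∀ H → Ψ.Φ.Carrier H → Φ.Φ.Carrier H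
      g H y = proj₁ (surjective H y)
      fg : ∀ H y → Ψ.Φ._≈_ H (⟦ f.hom H ⟧ (g H y)) y
      fg H y = proj₂ (surjective H y)

  -- The comparison map `θ` with its explicit formula starts at the given Mackey functor, whereas
  -- the counit ends there. This reverses its naturality square.
  inverse-natural : ∀ {Φ Φ′ Ψ Ψ′ : MackeyFunctor G} →
    let module Φ′ = MackeyFunctor Φ′
        module Ψ  = MackeyFunctor Ψ
        module Ψ′ = MackeyFunctor Ψ′
        open MackeyHom in
    (s : MackeyHom G Φ Φ′) (t : MackeyHom G Ψ Ψ′) (f : MackeyHom G Φ Ψ) (f′ : MackeyHom G Φ′ Ψ′) →
    (s⁻ : ∀ H y → ∃[ x ] Φ′.Φ._≈_ H (⟦ hom s H ⟧ x) y) →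
    (∀ H {x y} → Ψ′.Φ._≈_ H (⟦ hom t H ⟧ x) (⟦ hom t H ⟧ y) → Ψ.Φ._≈_ H x y) →
    (t⁻ : ∀ H y → ∃[ x ] Ψ′.Φ._≈_ H (⟦ hom t H ⟧ x) y) →
    (∀ H x → Ψ′.Φ._≈_ H (⟦ hom t H ⟧ (⟦ hom f H ⟧ x)) (⟦ hom f′ H ⟧ (⟦ hom s H ⟧ x))) →
    ∀ H y → Ψ.Φ._≈_ H (proj₁ (t⁻ H (⟦ hom f′ H ⟧ y))) (⟦ hom f H ⟧ (proj₁ (s⁻ H y)))
  inverse-natural {Ψ′ = Ψ′} s t f f′ s⁻ t-injective t⁻ square H y =
    t-injective H (Ψ′.trans (proj₂ (t⁻ H _)) (Ψ′.sym (Ψ′.trans (square H _)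
      (GroupHomomorphism.⟦⟧-cong (MackeyHom.hom f′ H) (proj₂ (s⁻ H y))))))
    where module Ψ′ = AbelianGroup (MackeyFunctor.Φ Ψ′ H)

  -- Finite index, normal cores and a small cofinal family

  module Classical (em : ExcludedMiddle (suc ℓ)) where

    -- Excluded middle is assumed one level up, where `Realises` lives; lifting brings it down to
    -- propositions such as membership in a subgroup.
    decide : (P : Set ℓ) → Dec P
    decide P = map′ lower lift (em {Lift (suc ℓ) P})

    -- A finite cover of G by cosets may repeat a coset and may leave the subgroup of interest. An
    -- element is kept only if it satisfies `P` and no kept element is equivalent to it.
    thin : ∀ {_∼_ : Rel Carrier ℓ} → IsEquivalence _∼_ → (P : Carrier → Set ℓ) → ∀ xs →
           ∃[ ys ] All P ys × AllPairs (λ x y → ¬ x ∼ y) ys ×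
                   (∀ {z} → Any (λ x → P x × x ∼ z) xs → Any (_∼ z) ys)
    thin ∼-equiv P [] = [] , [] , [] , λ ()
    thin {_∼_} ∼-equiv P (x ∷ xs) with thin ∼-equiv P xs | decide (P x)
    ... | ys , ps , ≁s , ⊇ | no ¬p =
      ys , ps , ≁s , λ { (here (p , _)) → contradiction p ¬p ; (there q) → ⊇ q }
    ... | ys , ps , ≁s , ⊇ | yes p with decide (Any (_∼ x) ys)
    ...   | yes q  = ys , ps , ≁s ,
                     λ { (here (_ , x∼z)) → Any.map (λ y∼x → ∼.trans y∼x x∼z) q ; (there r) → ⊇ r }
      where module ∼ = IsEquivalence ∼-equiv
    ...   | no ¬q  = x ∷ ys , p ∷ ps , All.map (λ ¬y∼x x∼y → ¬y∼x (∼.sym x∼y)) (All.¬Any⇒All¬ ys ¬q) ∷ ≁s ,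
                     λ { (here (_ , x∼z)) → here x∼z ; (there r) → there (⊇ r) }
      where module ∼ = IsEquivalence ∼-equiv

    opaque
      transversal : ∀ H I → I ≤ H → ∃[ cs ] Transversal H I cs
      transversal H I I≤H =
        let (xs , all) = compact (λ g → coset g I) (λ g → coset-open g I)
                           (λ x → x , S.resp I (sym (inverseˡ x)) (S.ε-closed I))
            (cs , inH , distinct , ⊇) = thin (∼-isEquivalence I) (_∈ₒ H) xs
        in cs , record
          { inH      = inH
          ; covers   = λ {x} x∈ → ⊇ (Any.map
              -- A listed g whose coset meets H lies in H itself: g = xj with x in H and j in I ≤ H.
              -- So discarding the elements outside H loses no coset of H.
              (λ {g} i∈ → let g∼x = g ⁻¹ ∙ x , i∈ , sym (\\-leftDividesˡ g x)
                              (j , j∈ , e) = IsEquivalence.sym (∼-isEquivalence I) g∼x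
                          in S.resp H (sym e) (S.∙-closed H x∈ (I≤H j∈)) , g∼x)
              (all x))
          ; distinct = distinct
          }

    -- The intersection of all conjugates of H; it is open because conj g H only depends
    -- on the coset gH, of which there are finitely many.
    core : OpenSubgroup → OpenSubgroup
    core H = record
      { subset    = subset
      ; isOpen    = open-resp {S.subset (⋂ cs)} {subset} ⋂⊆ (λ x∈ → ⊆⋂ cs x∈) (S.isOpen (⋂ cs))
      ; ε-closed  = λ g → S.ε-closed (conj g H)
      ; ∙-closed  = λ x∈ y∈ g → S.∙-closed (conj g H) (x∈ g) (y∈ g)
      ; ⁻¹-closed = λ x∈ g → S.⁻¹-closed (conj g H) (x∈ g)
      }
      where
      cs = proj₁ (transversal whole H (λ _ → tt))
      open Transversal (proj₂ (transversal whole H (λ _ → tt)))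

      subset : Subset setoid
      subset = record
        { member = λ x → ∀ g → x ∈ₒ conj g H ; resp = λ e x∈ g → S.resp (conj g H) e (x∈ g) }

      ⋂ : List Carrier → OpenSubgroup
      ⋂ = foldr (λ c K → conj c H ∩ₒ K) whole

      ⊆⋂ : ∀ cs {x} → x ∈ subset → x ∈ₒ ⋂ cs
      ⊆⋂ []       x∈ = tt
      ⊆⋂ (c ∷ cs) x∈ = x∈ c , ⊆⋂ cs x∈

      ∈⋂ : ∀ {cs x g} → Any (_∼⟨ H ⟩ g) cs → x ∈ₒ ⋂ cs → x ∈ₒ conj g H
      ∈⋂ {c ∷ _} {x} {g} (here (i , i∈ , e)) (x∈ , _) =
        proj₂ (conj-cong H e) {x} (proj₁ (conj-comp c i H) {x} (proj₁ (conj-self H i∈) x∈))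
      ∈⋂ {_ ∷ cs} (there p) (_ , x∈) = ∈⋂ {cs} p x∈

      ⋂⊆ : ∀ {x} → x ∈ₒ ⋂ cs → x ∈ subset
      ⋂⊆ x∈ g = ∈⋂ {cs} (covers {g} tt) x∈

    -- Conjugation by g permutes the conjugates of H: gxg⁻¹ lies in the conjugate by k when x lies
    -- in the conjugate by g⁻¹k.
    core-normal : ∀ H → IsNormal (core H)
    core-normal H g {x} x∈ k = S.resp H (∙-congʳ (∙-congˡ (∙-congʳ (∙-congʳ (⁻¹-involutive g)))))
      (proj₂ (conj-comp (g ⁻¹) k H) {x} (x∈ (g ⁻¹ ∙ k)))

    core≤ : ∀ H → core H ≤ H
    core≤ H x∈ = proj₂ (conj-self H (S.ε-closed H)) (x∈ ε)

    -- A family of normal open subgroups indexed by a type in Set ℓ, rather than in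
    -- Set (suc ℓ): by excluded middle a subset is given by its Bool-valued characteristic
    -- function.
    Realises : (Carrier → Bool) → Set (suc ℓ)
    Realises χ = ∃[ U ] IsNormal U × (∀ {x} → x ∈ₒ U → T (χ x)) × (∀ {x} → T (χ x) → x ∈ₒ U)

    -- `True` replaces the large type `Realises χ` by a small proposition, from which `toWitness`
    -- recovers a subgroup.
    Index : Set ℓ
    Index = ∃[ χ ] True (em {Realises χ})

    ⟨_⟩ : Index → OpenSubgroup
    ⟨ χ , r ⟩ = proj₁ (toWitness {a? = em {Realises χ}} r)

    normal : ∀ i → IsNormal ⟨ i ⟩
    normal (χ , r) = proj₁ (proj₂ (toWitness {a? = em {Realises χ}} r))

    opaque
      -- The recovered subgroup need not be `core H` itself, but it has the same characteristic
      -- function, and so the same elements.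
      cofinal : ∀ H → ∃[ i ] ⟨ i ⟩ ≤ H
      cofinal H = (χ , r) , λ x∈ → core≤ H (toWitness {a? = decide _}
                    (proj₁ (proj₂ (proj₂ (toWitness {a? = em {Realises χ}} r))) x∈))
        where
        χ : Carrier → Bool
        χ x = ⌊ decide (x ∈ₒ core H) ⌋
        r : True (em {Realises χ})
        r = fromWitness {a? = em {Realises χ}}
          (core H , core-normal H , (λ x∈ → fromWitness {a? = decide _} x∈) , λ t → toWitness {a? = decide _} t)

    -- The functor of fixed points

    module FixedPoints (M : DiscreteModule G) where
      private
        module M = DiscreteModule M
      open M using (_·_; ·-cong; ·-assoc; ·-ε)

      Fixes : OpenSubgroup → M.Carrier → Set ℓ
      Fixes H x = ∀ {h} → h ∈ₒ H → h · x M.≈ x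

      Fix : OpenSubgroup → AbelianGroup ℓ ℓ
      Fix H = record
        { Carrier = ∃[ x ] Fixes H x
        ; _≈_     = λ (x , _) (y , _) → x M.≈ y
        ; _∙_     = λ (x , p) (y , q) → x M.∙ y , λ h∈ → M.trans (M.·-∙ _ x y) (M.∙-cong (p h∈) (q h∈))
        ; ε       = M.ε , λ _ → GroupHomomorphism.ε-homo (M.·-hom _)
        ; _⁻¹     = λ (x , p) → x M.⁻¹ ,
                      λ h∈ → M.trans (GroupHomomorphism.⁻¹-homo (M.·-hom _) x) (M.⁻¹-cong (p h∈))
        ; isAbelianGroup = record
          { isGroup = record
            { isMonoid = record
              { isSemigroup = record
                { isMagma = record
                  { isEquivalence = record { refl = M.refl ; sym = M.sym ; trans = M.trans }
                  ; ∙-cong = M.∙-cong }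
                ; assoc = λ _ _ _ → M.assoc _ _ _ }
              ; identity = (λ _ → M.identityˡ _) , (λ _ → M.identityʳ _) }
            ; inverse = (λ _ → M.inverseˡ _) , (λ _ → M.inverseʳ _)
            ; ⁻¹-cong = M.⁻¹-cong }
          ; comm = λ _ _ → M.comm _ _ }
        }

      inclusion : ∀ H → Fix H →ᴬ M.M
      inclusion H = mkHom {A = Fix H} {B = M.M} proj₁ (λ e → e) (λ _ _ → M.refl)

      trace : List Carrier → M.Carrier → M.Carrier
      trace cs x = ∑ M.M cs (_· x)

      -- For x fixed by I, the element c · x depends only on the coset cI. The axioms that involve
      -- induction all reduce to this.
      trace-unique : ∀ {H I cs ds x} → Transversal H I cs → Transversal H I ds → Fixes I x →
                     trace cs x M.≈ trace ds x
      trace-unique {I = I} {cs} {ds} s t fixed = ∑-transversal M.M (∼-isEquivalence I)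
        (λ (i , i∈ , d≈ci) → M.sym (M.trans (·-cong d≈ci M.refl)
          (M.trans (·-assoc _ i _) (·-cong refl (fixed i∈)))))
        cs ds s.distinct t.distinct (All.map t.covers s.inH) (All.map s.covers t.inH)
        where
        module s = Transversal s
        module t = Transversal t

      ·-trace : ∀ g cs x → g · trace cs x M.≈ trace (map (g ∙_) cs) x
      ·-trace g cs x = M.trans (hom-∑ M.M M.M (M.·-hom g) cs (_· x))
        (M.trans (∑-cong M.M cs (λ c → M.sym (·-assoc g c x))) (M.sym (∑-map M.M (g ∙_) cs (_· x))))

      trace-cong : ∀ cs {x y} → x M.≈ y → trace cs x M.≈ trace cs y
      trace-cong cs e = ∑-cong M.M cs (λ c → ·-cong refl e)

      fixed-conj : ∀ g {H x} → Fixes H x → Fixes (conj g H) (g · x)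
      fixed-conj g {H} {x} fixed {k} k∈ = M.trans (M.sym (·-assoc k g x))
        (M.trans (·-cong (sym (conj-slide g k)) M.refl)
          (M.trans (·-assoc g _ x) (·-cong refl (fixed k∈))))

      restriction : ∀ I H → I ≤ H → Fix H →ᴬ Fix I
      restriction I H I≤H = mkHom {A = Fix H} {B = Fix I}
        (λ (x , fixed) → x , λ i∈ → fixed (I≤H i∈)) (λ e → e) (λ _ _ → M.refl)

      induction : ∀ H I → I ≤ H → Fix I →ᴬ Fix H
      induction H I I≤H = mkHom {A = Fix I} {B = Fix H}
        -- Multiplying a transversal of H/I on the left by h in H gives another one, so h fixes the
        -- trace.
        (λ (x , fixed) → trace cs x , λ {h} h∈ →
          M.trans (·-trace h cs x) (trace-unique (translate h∈ t) t fixed))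
        (trace-cong cs)
        (λ (x , _) (y , _) → M.trans (∑-cong M.M cs (λ c → M.·-∙ c x y)) (∑-∙ M.M cs (_· x) (_· y)))
        where
        cs = proj₁ (transversal H I I≤H)
        t  = proj₂ (transversal H I I≤H)

      conjugation : ∀ g H → Fix H →ᴬ Fix (conj g H)
      conjugation g H = mkHom {A = Fix H} {B = Fix (conj g H)}
        (λ (x , fixed) → g · x , fixed-conj g {H} fixed) (·-cong refl) (λ (x , _) (y , _) → M.·-∙ g x y)

      trace-concatMap : ∀ (T : Carrier → List Carrier) cs x →
                        trace (concatMap T cs) x M.≈ ∑ M.M cs (λ c → trace (T c) x)
      trace-concatMap T cs x = ∑-concatMap M.M T cs (_· x)

      fixedPoints : MackeyFunctor G
      fixedPoints = record
        { Φ        = Fix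
        ; res      = restriction
        ; ind      = induction
        ; con      = conjugation
        ; res-id   = λ _ _ _ → M.refl
        -- When the two subgroups have the same elements, ε alone is a transversal, and the trace
        -- over it is x.
        ; ind-id   = λ H K (H≤K , K≤H) (x , fixed) →
            M.trans (trace-unique (proj₂ (transversal K H H≤K)) (singleton K≤H) fixed)
                    (M.trans (M.identityʳ _) (·-ε x))
        ; con-id   = λ H h∈ (x , fixed) → fixed h∈
        ; con-cong = λ H e x → ·-cong e M.refl
        ; res-res  = λ _ _ _ _ _ _ _ → M.refl
        ; ind-ind  = λ H I J q p r (x , fixed) →
            let (cs , s) = transversal H I q
                (ds , t) = transversal I J p
            in M.trans (∑-cong M.M cs (λ c → ·-trace c ds x))
                 (M.trans (M.sym (trace-concatMap (λ c → map (c ∙_) ds) cs x))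
                   (trace-unique (tower q p s t) (proj₂ (transversal H J r)) fixed))
        ; con-con  = λ g′ g H (x , _) → M.sym (·-assoc g′ g x)
        ; con-res  = λ _ _ _ _ _ → M.refl
        -- Conjugating a transversal of H/I by g gives one of the conjugate pair, and g · c · x =
        -- (gcg⁻¹) · g · x.
        ; con-ind  = λ g H I p (x , fixed) →
            let (cs , s) = transversal H I p
                (ds , t) = transversal (conj g H) (conj g I) p
            in M.trans (hom-∑ M.M M.M (M.·-hom g) cs (_· x))
                 (M.trans (∑-cong M.M cs (λ c → conjugated g c x))
                   (M.trans (M.sym (∑-map M.M (λ c → g ∙ c ∙ g ⁻¹) cs (_· (g · x))))
                     (trace-unique (conjugate g s) t (fixed-conj g {I} fixed))))
        -- Both sides are traces of x over a transversal of H/J: the chosen one on the left, the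
        -- products th on the right. The inclusion of M^I moves the outer sum into M.
        ; mackey   = λ I J H p q hs reps (x , fixed) →
            let T : Carrier → List Carrier
                T h = proj₁ (transversal I (I ∩ₒ conj h J) proj₁)
            in M.trans (trace-unique (proj₂ (transversal H J q))
                         (double-coset-refine T p reps (λ h → proj₂ (transversal I (I ∩ₒ conj h J) proj₁)))
                         fixed)
                 (M.trans (trace-concatMap (λ h → map (_∙ h) (T h)) hs x)
                   (M.trans (∑-cong M.M hs (λ h → M.trans (∑-map M.M (_∙ h) (T h) (_· x))
                              (∑-cong M.M (T h) (λ c → ·-assoc c h x))))
                     (M.sym (hom-∑ (Fix I) M.M (inclusion I) hs _))))
        }
        where
        conjugated : ∀ g c x → g · c · x M.≈ (g ∙ c ∙ g ⁻¹) · g · x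
        conjugated g c x = M.trans (M.sym (·-assoc g c x))
          (M.trans (·-cong (sym (//-rightDividesˡ g (g ∙ c))) M.refl) (·-assoc _ g x))

      -- An H/U-invariant of M^U is just an element of M fixed by all of H, so the map is the
      -- identity on underlying elements.
      fixedPoints-descent : HasGaloisDescent G fixedPoints
      fixedPoints-descent H U n U≤H = record
        { isGroupMonomorphism = record
          { isGroupHomomorphism = GroupHomomorphism.isGroupHomomorphism
              (mkHom {A = Fix H} {B = Action.Invariants (conAction G fixedPoints H U n)}
                (resInvariants G fixedPoints H U n U≤H) (λ e → e) (λ _ _ → M.refl))
          ; injective = λ e → e }
        ; surjective = λ ((x , _) , invariant) → (x , λ {h} h∈ → invariant (h , h∈)) , λ e → e
        }

    open FixedPoints using (fixedPoints; fixedPoints-descent)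

    fixedPoints₁ : ∀ {M N} → ModuleHom G M N → MackeyHom G (fixedPoints M) (fixedPoints N)
    fixedPoints₁ {M} {N} f = record
      { hom      = λ H → mkHom {A = FixedPoints.Fix M H} {B = FixedPoints.Fix N H}
                     (λ (x , fixed) → ⟦ f.hom ⟧ x ,
                       λ h∈ → N.trans (N.sym (f.equivariant _ x)) (f.⟦⟧-cong (fixed h∈)))
                     f.⟦⟧-cong (λ (x , _) (y , _) → f.homo x y)
      ; comm-res = λ _ _ _ _ → N.refl
      ; comm-ind = λ H I p (x , _) → let cs = proj₁ (transversal H I p) in
                     N.trans (hom-∑ M.M N.M f.hom cs (λ c → c M.· x))
                       (∑-cong N.M cs (λ c → f.equivariant c x))
      ; comm-con = λ g H (x , _) → f.equivariant g x
      }
      where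
      module M = DiscreteModule M
      module N = DiscreteModule N
      module f where
        open ModuleHom f public
        open GroupHomomorphism (ModuleHom.hom f) public using (⟦⟧-cong; homo)

    Fixed : Functor (DiscreteModules G) (MackGal G)
    Fixed = record
      { F₀           = λ M → fixedPoints M , fixedPoints-descent M
      ; F₁           = fixedPoints₁
      ; F-resp-≈     = λ e H (x , _) → e x
      ; identity     = λ {M} H _ → DiscreteModule.refl M
      ; homomorphism = λ {_} {_} {N} H _ → DiscreteModule.refl N
      }

    -- The colimit over the normal open subgroups

    module Germs (Ψ : MackeyFunctor G) (descent : HasGaloisDescent G Ψ) where
      open MackeyFunctor Ψ

      res-cong : ∀ I H (p : I ≤ H) {x y} → Φ._≈_ H x y → Φ._≈_ I (⟦ res I H p ⟧ x) (⟦ res I H p ⟧ y)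
      res-cong I H p = GroupHomomorphism.⟦⟧-cong (res I H p)

      -- In `res-res` the proof of the composite inclusion is arbitrary, so composing with an
      -- identity restriction exchanges one proof for another.
      res-irrelevant : ∀ I H (p q : I ≤ H) x → Φ._≈_ I (⟦ res I H p ⟧ x) (⟦ res I H q ⟧ x)
      res-irrelevant I H p q x =
        Φ.trans I (Φ.sym I (res-id I (λ i → i) _)) (res-res I I H (λ i → i) p q x)

      res-injective : ∀ U H → IsNormal U → (p : U ≤ H) → ∀ {x y} →
                      Φ._≈_ U (⟦ res U H p ⟧ x) (⟦ res U H p ⟧ y) → Φ._≈_ H x y
      res-injective U H n p = GroupMorphisms.IsGroupIsomorphism.injective (descent H U n p)

      -- With G as ambient group every g acts on Φ(U). The formula for the action does not involve
      -- the ambient group, so it agrees with the H/U-action in the descent condition.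
      actions : ∀ U (n : IsNormal U) → Action (Quotient whole U n) (Φ U)
      actions U n = conAction G Ψ whole U n

      act : ∀ U → IsNormal U → Carrier → Φ.Carrier U → Φ.Carrier U
      act U n g = Action._·_ (actions U n) (g , tt)

      act-cong : ∀ U (n : IsNormal U) g {x y} → Φ._≈_ U x y → Φ._≈_ U (act U n g x) (act U n g y)
      act-cong U n g = Action.·-cong (actions U n) {g , tt} {g , tt} (Group.refl (Quotient whole U n) {g , tt})

      -- Computes the action on a restricted element from con on H, which need not be normal. This
      -- links germs to the values Φ(H) at arbitrary open subgroups.
      act-res : ∀ W (n : IsNormal W) g H (p : W ≤ H) (q : W ≤ conj g H) x →
                Φ._≈_ W (act W n g (⟦ res W H p ⟧ x)) (⟦ res W (conj g H) q ⟧ (⟦ con g H ⟧ x))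
      act-res W n g H p q x = Φ.trans W
        (res-cong W (conj g W) (proj₂ (normal-conj g {W} n)) (con-res g W H p x))
        (res-res W (conj g W) (conj g H) _ (conj-mono g {W} {H} p) q _)

      res-act : ∀ V U (m : IsNormal V) (n : IsNormal U) (p : V ≤ U) g x →
                Φ._≈_ V (⟦ res V U p ⟧ (act U n g x)) (act V m g (⟦ res V U p ⟧ x))
      res-act V U m n p g x = Φ.trans V
        (res-res V U (conj g U) p (proj₂ (normal-conj g {U} n)) q _)
        (Φ.sym V (act-res V m g U p q x))
        where
        q : V ≤ conj g U
        q v∈ = proj₂ (normal-conj g {U} n) (p v∈)

      Germ : Set ℓ
      Germ = ∃[ i ] Φ.Carrier ⟨ i ⟩

      ∣_∣ : Germ → OpenSubgroup
      ∣ a ∣ = ⟨ proj₁ a ⟩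

      at : ∀ W a → W ≤ ∣ a ∣ → Φ.Carrier W
      at W a p = ⟦ res W ∣ a ∣ p ⟧ (proj₂ a)

      infix 4 _≋_

      -- By descent restriction is injective, so agreement on the intersection is the same as
      -- agreement on some smaller subgroup.
      record _≋_ (a b : Germ) : Set ℓ where
        constructor agree
        field
          agreement : Φ._≈_ (∣ a ∣ ∩ₒ ∣ b ∣) (at (∣ a ∣ ∩ₒ ∣ b ∣) a proj₁) (at (∣ a ∣ ∩ₒ ∣ b ∣) b proj₂)
      open _≋_ public

      ≋-intro : ∀ W → IsNormal W → ∀ a b (p : W ≤ ∣ a ∣) (q : W ≤ ∣ b ∣) →
                Φ._≈_ W (at W a p) (at W b q) → a ≋ b
      ≋-intro W n a b p q e = agree (res-injective W (∣ a ∣ ∩ₒ ∣ b ∣) n (λ w → p w , q w) (Φ.trans W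
        (res-res W (∣ a ∣ ∩ₒ ∣ b ∣) ∣ a ∣ _ proj₁ p _)
        (Φ.trans W e (Φ.sym W (res-res W (∣ a ∣ ∩ₒ ∣ b ∣) ∣ b ∣ _ proj₂ q _)))))

      ≋-elim : ∀ W a b (p : W ≤ ∣ a ∣) (q : W ≤ ∣ b ∣) → a ≋ b → Φ._≈_ W (at W a p) (at W b q)
      ≋-elim W a b p q e = Φ.trans W
        (Φ.sym W (res-res W (∣ a ∣ ∩ₒ ∣ b ∣) ∣ a ∣ (λ w → p w , q w) proj₁ p _))
        (Φ.trans W (res-cong W (∣ a ∣ ∩ₒ ∣ b ∣) (λ w → p w , q w) (agreement e))
          (res-res W (∣ a ∣ ∩ₒ ∣ b ∣) ∣ b ∣ (λ w → p w , q w) proj₂ q _))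

      ι-cong : ∀ i {x y} → Φ._≈_ ⟨ i ⟩ x y → (i , x) ≋ (i , y)
      ι-cong i {x} {y} e = agree (Φ.trans W (res-irrelevant W ⟨ i ⟩ proj₁ proj₂ x) (res-cong W ⟨ i ⟩ proj₂ e))
        where
        W = ⟨ i ⟩ ∩ₒ ⟨ i ⟩

      meet : Index → Index → Index
      meet i j = proj₁ (cofinal (⟨ i ⟩ ∩ₒ ⟨ j ⟩))

      meetˡ : ∀ i j → ⟨ meet i j ⟩ ≤ ⟨ i ⟩
      meetˡ i j x∈ = proj₁ (proj₂ (cofinal (⟨ i ⟩ ∩ₒ ⟨ j ⟩)) x∈)

      meetʳ : ∀ i j → ⟨ meet i j ⟩ ≤ ⟨ j ⟩
      meetʳ i j x∈ = proj₂ (proj₂ (cofinal (⟨ i ⟩ ∩ₒ ⟨ j ⟩)) x∈)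

      infixl 7 _⊕_

      _⊕_ : Germ → Germ → Germ
      a ⊕ b = k , Φ._∙_ ⟨ k ⟩ (at ⟨ k ⟩ a (meetˡ (proj₁ a) (proj₁ b))) (at ⟨ k ⟩ b (meetʳ (proj₁ a) (proj₁ b)))
        where k = meet (proj₁ a) (proj₁ b)

      ⊕≤ˡ : ∀ a b → ∣ a ⊕ b ∣ ≤ ∣ a ∣
      ⊕≤ˡ a b = meetˡ (proj₁ a) (proj₁ b)

      ⊕≤ʳ : ∀ a b → ∣ a ⊕ b ∣ ≤ ∣ b ∣
      ⊕≤ʳ a b = meetʳ (proj₁ a) (proj₁ b)

      -- The group laws for germs follow by restricting both sides to a common W, where sums become
      -- sums in Φ(W).
      at-⊕ : ∀ W a b (r : W ≤ ∣ a ⊕ b ∣) (p : W ≤ ∣ a ∣) (q : W ≤ ∣ b ∣) →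
             Φ._≈_ W (at W (a ⊕ b) r) (Φ._∙_ W (at W a p) (at W b q))
      at-⊕ W a b r p q = Φ.trans W (GroupHomomorphism.homo (res W ∣ a ⊕ b ∣ r) _ _)
        (Φ.∙-cong W (res-res W ∣ a ⊕ b ∣ ∣ a ∣ r (⊕≤ˡ a b) p _)
                    (res-res W ∣ a ⊕ b ∣ ∣ b ∣ r (⊕≤ʳ a b) q _))

      0# : Germ
      0# = proj₁ (cofinal whole) , Φ.ε _

      ⊖_ : Germ → Germ
      ⊖ (i , x) = i , Φ._⁻¹ ⟨ i ⟩ x

      at-0 : ∀ W (p : W ≤ ∣ 0# ∣) → Φ._≈_ W (at W 0# p) (Φ.ε W)
      at-0 W p = GroupHomomorphism.ε-homo (res W ∣ 0# ∣ p)

      at-⊖ : ∀ W a (p : W ≤ ∣ a ∣) → Φ._≈_ W (at W (⊖ a) p) (Φ._⁻¹ W (at W a p))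
      at-⊖ W a p = GroupHomomorphism.⁻¹-homo (res W ∣ a ∣ p) (proj₂ a)

      ≋-refl : ∀ {a} → a ≋ a
      ≋-refl {i , x} = ι-cong i (Φ.refl ⟨ i ⟩)

      ≋-sym : ∀ {a b} → a ≋ b → b ≋ a
      ≋-sym {a} {b} e = agree (Φ.sym W (≋-elim W a b proj₂ proj₁ e))
        where
        W = ∣ b ∣ ∩ₒ ∣ a ∣

      -- The two hypotheses can be combined only on the triple intersection; descent, through
      -- `≋-intro`, carries the agreement back up to the intersection of the outer two.
      ≋-trans : ∀ {a b c} → a ≋ b → b ≋ c → a ≋ c
      ≋-trans {a} {b} {c} e f = ≋-intro W
        (∩-normal {∣ a ∣} {∣ b ∣ ∩ₒ ∣ c ∣} (normal (proj₁ a))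
          (∩-normal {∣ b ∣} {∣ c ∣} (normal (proj₁ b)) (normal (proj₁ c))))
        a c W≤a W≤c (Φ.trans W (≋-elim W a b W≤a W≤b e) (≋-elim W b c W≤b W≤c f))
        where
        W = ∣ a ∣ ∩ₒ (∣ b ∣ ∩ₒ ∣ c ∣)
        W≤a : W ≤ ∣ a ∣
        W≤a = proj₁
        W≤b : W ≤ ∣ b ∣
        W≤b w = proj₁ (proj₂ w)
        W≤c : W ≤ ∣ c ∣
        W≤c w = proj₂ (proj₂ w)

      ⊕-cong : ∀ {a a′ b b′} → a ≋ a′ → b ≋ b′ → a ⊕ b ≋ a′ ⊕ b′
      ⊕-cong {a} {a′} {b} {b′} e f = agree (Φ.trans W (at-⊕ W a b proj₁ p q)
        (Φ.trans W (Φ.∙-cong W (≋-elim W a a′ p p′ e) (≋-elim W b b′ q q′ f))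
          (Φ.sym W (at-⊕ W a′ b′ proj₂ p′ q′))))
        where
        W = ∣ a ⊕ b ∣ ∩ₒ ∣ a′ ⊕ b′ ∣
        p : W ≤ ∣ a ∣
        p w = ⊕≤ˡ a b (proj₁ w)
        q : W ≤ ∣ b ∣
        q w = ⊕≤ʳ a b (proj₁ w)
        p′ : W ≤ ∣ a′ ∣
        p′ w = ⊕≤ˡ a′ b′ (proj₂ w)
        q′ : W ≤ ∣ b′ ∣
        q′ w = ⊕≤ʳ a′ b′ (proj₂ w)

      ⊕-assoc : ∀ a b c → (a ⊕ b) ⊕ c ≋ a ⊕ (b ⊕ c)
      ⊕-assoc a b c = agree (Φ.trans W (at-⊕ W (a ⊕ b) c proj₁ pq r)
        (Φ.trans W (Φ.∙-congʳ W (at-⊕ W a b pq p q))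
          (Φ.trans W (Φ.assoc W _ _ _)
            (Φ.sym W (Φ.trans W (at-⊕ W a (b ⊕ c) proj₂ p qr) (Φ.∙-congˡ W (at-⊕ W b c qr q r)))))))
        where
        W = ∣ (a ⊕ b) ⊕ c ∣ ∩ₒ ∣ a ⊕ (b ⊕ c) ∣
        pq : W ≤ ∣ a ⊕ b ∣
        pq w = ⊕≤ˡ (a ⊕ b) c (proj₁ w)
        qr : W ≤ ∣ b ⊕ c ∣
        qr w = ⊕≤ʳ a (b ⊕ c) (proj₂ w)
        p : W ≤ ∣ a ∣
        p w = ⊕≤ˡ a b (pq w)
        q : W ≤ ∣ b ∣
        q w = ⊕≤ʳ a b (pq w)
        r : W ≤ ∣ c ∣
        r w = ⊕≤ʳ (a ⊕ b) c (proj₁ w)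

      ⊕-comm : ∀ a b → a ⊕ b ≋ b ⊕ a
      ⊕-comm a b = agree (Φ.trans W (at-⊕ W a b proj₁ p q)
        (Φ.trans W (Φ.comm W _ _) (Φ.sym W (at-⊕ W b a proj₂ q p))))
        where
        W = ∣ a ⊕ b ∣ ∩ₒ ∣ b ⊕ a ∣
        p : W ≤ ∣ a ∣
        p w = ⊕≤ˡ a b (proj₁ w)
        q : W ≤ ∣ b ∣
        q w = ⊕≤ʳ a b (proj₁ w)

      ⊕-identityˡ : ∀ a → 0# ⊕ a ≋ a
      ⊕-identityˡ a = agree (Φ.trans W (at-⊕ W 0# a proj₁ p proj₂)
        (Φ.trans W (Φ.∙-congʳ W (at-0 W p)) (Φ.identityˡ W _)))
        where
        W = ∣ 0# ⊕ a ∣ ∩ₒ ∣ a ∣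
        p : W ≤ ∣ 0# ∣
        p w = ⊕≤ˡ 0# a (proj₁ w)

      ⊕-inverseˡ : ∀ a → (⊖ a) ⊕ a ≋ 0#
      ⊕-inverseˡ a = agree (Φ.trans W (at-⊕ W (⊖ a) a proj₁ p p)
        (Φ.trans W (Φ.∙-congʳ W (at-⊖ W a p))
          (Φ.trans W (Φ.inverseˡ W _) (Φ.sym W (at-0 W proj₂)))))
        where
        W = ∣ (⊖ a) ⊕ a ∣ ∩ₒ ∣ 0# ∣
        p : W ≤ ∣ a ∣
        p w = ⊕≤ʳ (⊖ a) a (proj₁ w)

      ⊖-cong : ∀ {a b} → a ≋ b → ⊖ a ≋ ⊖ b
      ⊖-cong {a} {b} e = agree (Φ.trans W (at-⊖ W a proj₁)
        (Φ.trans W (Φ.⁻¹-cong W (agreement e)) (Φ.sym W (at-⊖ W b proj₂))))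
        where
        W = ∣ a ∣ ∩ₒ ∣ b ∣

      germs : AbelianGroup ℓ ℓ
      germs = record
        { Carrier = Germ
        ; _≈_     = _≋_
        ; _∙_     = _⊕_
        ; ε       = 0#
        ; _⁻¹     = ⊖_
        ; isAbelianGroup = record
          { isGroup = record
            { isMonoid = record
              { isSemigroup = record
                { isMagma = record
                  { isEquivalence = record
                    { refl = ≋-refl ; sym = ≋-sym ; trans = ≋-trans }
                  ; ∙-cong = ⊕-cong }
                ; assoc = ⊕-assoc }
              ; identity = ⊕-identityˡ ,
                           λ a → ≋-trans (⊕-comm a 0#) (⊕-identityˡ a) }
            ; inverse = ⊕-inverseˡ ,
                        λ a → ≋-trans (⊕-comm a (⊖ a)) (⊕-inverseˡ a)
            ; ⁻¹-cong = ⊖-cong }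
          ; comm = ⊕-comm }
        }

      infixr 8 _⊙_

      _⊙_ : Carrier → Germ → Germ
      g ⊙ (i , x) = i , act ⟨ i ⟩ (normal i) g x

      ⊙-cong : ∀ g {a b} → a ≋ b → g ⊙ a ≋ g ⊙ b
      ⊙-cong g {i , x} {j , y} e = agree (Φ.trans W (res-act W ⟨ i ⟩ n (normal i) proj₁ g x)
        (Φ.trans W (act-cong W n g (agreement e))
          (Φ.sym W (res-act W ⟨ j ⟩ n (normal j) proj₂ g y))))
        where
        W = ⟨ i ⟩ ∩ₒ ⟨ j ⟩
        n : IsNormal W
        n = ∩-normal {⟨ i ⟩} {⟨ j ⟩} (normal i) (normal j)

      -- Φ(U) carries an action of G/U. Hence g ↦ g ⊙ a is locally constant, which gives continuity
      -- of the action.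
      ⊙-coset : ∀ a {g h} → g ⁻¹ ∙ h ∈ₒ ∣ a ∣ → g ⊙ a ≋ h ⊙ a
      ⊙-coset (i , x) {g} {h} u∈ = ι-cong i
        (Action.·-cong (actions ⟨ i ⟩ (normal i)) {g , tt} {h , tt} u∈ (Φ.refl ⟨ i ⟩))

      ⊙-action : Action group germs
      ⊙-action = record
        { _·_     = _⊙_
        ; ·-cong  = λ {g} {h} {a} {b} g≈h e → ≋-trans
                      (⊙-coset a (S.resp ∣ a ∣ (trans (sym (inverseˡ g)) (∙-congˡ g≈h)) (S.ε-closed ∣ a ∣)))
                      (⊙-cong h e)
        ; ·-ε     = λ (i , x) → ι-cong i (Action.·-ε (actions ⟨ i ⟩ (normal i)) x)
        ; ·-assoc = λ g h (i , x) →
                      ι-cong i (Action.·-assoc (actions ⟨ i ⟩ (normal i)) (g , tt) (h , tt) x)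
        ; ·-∙     = λ g a b → let k = proj₁ (a ⊕ b) in ι-cong k (Φ.trans ⟨ k ⟩
                      (Action.·-∙ (actions ⟨ k ⟩ (normal k)) (g , tt) _ _)
                      (Φ.∙-cong ⟨ k ⟩
                        (Φ.sym ⟨ k ⟩ (res-act ⟨ k ⟩ ∣ a ∣ (normal k) (normal (proj₁ a)) (⊕≤ˡ a b) g _))
                        (Φ.sym ⟨ k ⟩ (res-act ⟨ k ⟩ ∣ b ∣ (normal k) (normal (proj₁ b)) (⊕≤ʳ a b) g _))))
        }

      -- Opaque because conversion checking would otherwise eta-expand it and compare the
      -- proofs inside.
      opaque
        germModule : DiscreteModule G
        germModule = record
          { M          = germs
          ; action     = ⊙-action
          ; continuous = λ A _ {g} {a} ga∈A →
                coset g ∣ a ∣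
              , record { member = a ≋_ ; resp = λ b≋c a≋b → ≋-trans a≋b b≋c }
              , coset-open g ∣ a ∣ , tt
              , S.resp ∣ a ∣ (sym (inverseˡ g)) (S.ε-closed ∣ a ∣)
              , ≋-refl
              , λ {h} {b} u∈ a≋b → Subset.resp A
                  (≋-trans (⊙-coset a u∈) (⊙-cong h a≋b)) ga∈A
          }

      -- The summands simplify since U ∩ cIc⁻¹ = U = c⁻¹Uc ∩ I.
      res-ind : ∀ U I H (n : IsNormal U) (p : U ≤ I) (q : I ≤ H) (r : U ≤ H) →
                ∀ {cs} → Transversal H I cs → ∀ x →
                Φ._≈_ U (⟦ res U H r ⟧ (⟦ ind H I q ⟧ x))
                        (∑ (Φ U) cs (λ c → act U n c (⟦ res U I p ⟧ x)))
      res-ind U I H n p q r {cs} t x = Φ.trans U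
        (mackey U I H r q cs (normal-double-cosets {U} n p t) x) (∑-cong (Φ U) cs term)
        where
        term : ∀ c → Φ._≈_ U
          (⟦ ind U (U ∩ₒ conj c I) proj₁ ⟧
            (coe {conj c ((U ^ c) ∩ₒ I)} {U ∩ₒ conj c I} (conj-∩ c U I)
              (⟦ con c ((U ^ c) ∩ₒ I) ⟧ (⟦ res ((U ^ c) ∩ₒ I) I proj₂ ⟧ x))))
          (act U n c (⟦ res U I p ⟧ x))
        term c = Φ.trans U (ind-id L U (proj₁ , U≤L) _)
          (Φ.trans U (res-res U L (conj c K) U≤L (proj₂ (conj-∩ c U I)) U≤cK _)
            (Φ.trans U (Φ.sym U (act-res U n c K U≤K U≤cK _))
              (act-cong U n c (res-res U K I U≤K proj₂ p x))))
          where
          K = (U ^ c) ∩ₒ I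
          L = U ∩ₒ conj c I
          U≤L : U ≤ L
          U≤L u = u , p (proj₂ (normal-conj c {U} n) u)
          U≤K : U ≤ K
          U≤K u = n c u , p u
          U≤cK : U ≤ conj c K
          U≤cK u = proj₂ (conj-∩ c U I) (U≤L u)

      ι-∙ : ∀ i x y → (i , Φ._∙_ ⟨ i ⟩ x y) ≋ (i , x) ⊕ (i , y)
      ι-∙ i x y = agree (Φ.trans W (GroupHomomorphism.homo (res W ⟨ i ⟩ proj₁) x y)
        (Φ.sym W (at-⊕ W (i , x) (i , y) proj₂ proj₁ proj₁)))
        where
        W = ⟨ i ⟩ ∩ₒ ∣ (i , x) ⊕ (i , y) ∣

      ι : ∀ i → Φ ⟨ i ⟩ →ᴬ germs
      ι i = mkHom {A = Φ ⟨ i ⟩} {B = germs} (i ,_) (ι-cong i) (ι-∙ i)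

      -- The comparison of Φ(H) with the germs fixed by H

      germ-of : ∀ {H} i → ⟨ i ⟩ ≤ H → Φ.Carrier H → Germ
      germ-of {H} i p x = i , ⟦ res ⟨ i ⟩ H p ⟧ x

      germ-of-res : ∀ {I H} i j (I≤H : I ≤ H) (p : ⟨ i ⟩ ≤ I) (q : ⟨ j ⟩ ≤ H) x →
                    germ-of {I} i p (⟦ res I H I≤H ⟧ x) ≋ germ-of {H} j q x
      germ-of-res {I} {H} i j I≤H p q x = agree (Φ.trans W (res-res W ⟨ i ⟩ I proj₁ p W≤I _)
        (Φ.trans W (res-res W I H W≤I I≤H W≤H x) (Φ.sym W (res-res W ⟨ j ⟩ H proj₂ q W≤H x))))
        where
        W = ⟨ i ⟩ ∩ₒ ⟨ j ⟩
        W≤I : W ≤ I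
        W≤I w = p (proj₁ w)
        W≤H : W ≤ H
        W≤H w = q (proj₂ w)

      germ-of-unique : ∀ {H} i j (p : ⟨ i ⟩ ≤ H) (q : ⟨ j ⟩ ≤ H) x →
                       germ-of {H} i p x ≋ germ-of {H} j q x
      germ-of-unique {H} i j p q x = agree (Φ.trans W (res-res W ⟨ i ⟩ H proj₁ p W≤H x)
        (Φ.sym W (res-res W ⟨ j ⟩ H proj₂ q W≤H x)))
        where
        W = ⟨ i ⟩ ∩ₒ ⟨ j ⟩
        W≤H : W ≤ H
        W≤H w = q (proj₂ w)

      below : OpenSubgroup → Index
      below H = proj₁ (cofinal H)

      below≤ : ∀ H → ⟨ below H ⟩ ≤ H
      below≤ H = proj₂ (cofinal H)

      θ₀ : ∀ H → Φ.Carrier H → Germ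
      θ₀ H = germ-of {H} (below H) (below≤ H)

      θ₀-cong : ∀ H {x y} → Φ._≈_ H x y → θ₀ H x ≋ θ₀ H y
      θ₀-cong H e = ι-cong (below H) (res-cong ⟨ below H ⟩ H (below≤ H) e)

      θ₀-fixed : ∀ H x {h} → h ∈ₒ H → h ⊙ θ₀ H x ≋ θ₀ H x
      θ₀-fixed H x {h} h∈ = ι-cong (below H)
        (proj₂ (resInvariants G Ψ H ⟨ below H ⟩ (normal (below H)) (below≤ H) x) (h , h∈))

      θ₀-∙ : ∀ H x y → θ₀ H (Φ._∙_ H x y) ≋ θ₀ H x ⊕ θ₀ H y
      θ₀-∙ H x y = ≋-trans
        (ι-cong (below H) (GroupHomomorphism.homo (res ⟨ below H ⟩ H (below≤ H)) x y))
        (ι-∙ (below H) x′ y′)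
        where
        x′ = ⟦ res ⟨ below H ⟩ H (below≤ H) ⟧ x
        y′ = ⟦ res ⟨ below H ⟩ H (below≤ H) ⟧ y

      θ₀-ind : ∀ H I (p : I ≤ H) x →
               θ₀ H (⟦ ind H I p ⟧ x) ≋ ∑ germs (proj₁ (transversal H I p)) (_⊙ θ₀ I x)
      θ₀-ind H I p x = ≋-trans
        -- The subgroup chosen below H need not lie in I, as `res-ind` requires, so the germ is
        -- first moved to the one chosen below I.
        (germ-of-unique {H} (below H) k (below≤ H) U≤H y)
        (≋-trans
          (ι-cong k (res-ind ⟨ k ⟩ I H (normal k) (below≤ I) p U≤H (proj₂ (transversal H I p)) x))
          (hom-∑ (Φ ⟨ k ⟩) germs (ι k) cs z))
        where
        k = below I
        cs = proj₁ (transversal H I p)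
        y = ⟦ ind H I p ⟧ x
        U≤H : ⟨ k ⟩ ≤ H
        U≤H u = p (below≤ I u)
        z : Carrier → Φ.Carrier ⟨ k ⟩
        z c = act ⟨ k ⟩ (normal k) c (⟦ res ⟨ k ⟩ I (below≤ I) ⟧ x)

      θ₀-con : ∀ g H x → θ₀ (conj g H) (⟦ con g H ⟧ x) ≋ g ⊙ θ₀ H x
      θ₀-con g H x = agree (Φ.trans W (res-res W ⟨ i ⟩ (conj g H) proj₁ (below≤ (conj g H)) W≤gH _)
        (Φ.trans W (Φ.sym W (act-res W n g H W≤H W≤gH x))
          (Φ.trans W (act-cong W n g (Φ.sym W (res-res W ⟨ j ⟩ H proj₂ (below≤ H) W≤H x)))
            (Φ.sym W (res-act W ⟨ j ⟩ n (normal j) proj₂ g _)))))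
        where
        i = below (conj g H)
        j = below H
        W = ⟨ i ⟩ ∩ₒ ⟨ j ⟩
        n : IsNormal W
        n = ∩-normal {⟨ i ⟩} {⟨ j ⟩} (normal i) (normal j)
        W≤gH : W ≤ conj g H
        W≤gH w = below≤ (conj g H) (proj₁ w)
        W≤H : W ≤ H
        W≤H w = below≤ H (proj₂ w)

      θ₀-injective : ∀ H {x y} → θ₀ H x ≋ θ₀ H y → Φ._≈_ H x y
      θ₀-injective H {x} {y} e = res-injective U H (normal (below H)) (below≤ H)
        (Φ.trans U (Φ.sym U (res-id U (λ u → u) _))
          (Φ.trans U (≋-elim U (θ₀ H x) (θ₀ H y) (λ u → u) (λ u → u) e)
            (res-id U (λ u → u) _)))
        where
        U = ⟨ below H ⟩

      -- On a normal subgroup below both H and the level of a, the fixed germ becomes an H-invariant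
      -- element, and descent lifts it to Φ(H). That subgroup may differ from the one in `θ₀`, so
      -- the two germs are compared on the intersection V.
      θ₀-surjective : ∀ H a → (∀ {h} → h ∈ₒ H → h ⊙ a ≋ a) → ∃[ x ] θ₀ H x ≋ a
      θ₀-surjective H a fixed = x ,
        ≋-intro V (∩-normal {⟨ k ⟩} {⟨ below H ⟩} (normal k) (normal (below H)))
          (θ₀ H x) a proj₂ V≤a
          (Φ.trans V (res-res V ⟨ below H ⟩ H proj₂ (below≤ H) V≤H x)
            (Φ.trans V (Φ.sym V (res-res V ⟨ k ⟩ H proj₁ k≤H V≤H x))
              (Φ.trans V (res-cong V ⟨ k ⟩ proj₁ res-x) (res-res V ⟨ k ⟩ ∣ a ∣ proj₁ k≤a V≤a _))))
        where
        k = below (∣ a ∣ ∩ₒ H)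
        V = ⟨ k ⟩ ∩ₒ ⟨ below H ⟩
        k≤a : ⟨ k ⟩ ≤ ∣ a ∣
        k≤a u = proj₁ (below≤ (∣ a ∣ ∩ₒ H) u)
        k≤H : ⟨ k ⟩ ≤ H
        k≤H u = proj₂ (below≤ (∣ a ∣ ∩ₒ H) u)
        V≤a : V ≤ ∣ a ∣
        V≤a v = k≤a (proj₁ v)
        V≤H : V ≤ H
        V≤H v = k≤H (proj₁ v)

        -- Being fixed is an equality of germs; `≋-elim` turns it into an equality in Φ at the
        -- smaller level.
        invariant : ∀ {h} → h ∈ₒ H →
          Φ._≈_ ⟨ k ⟩ (act ⟨ k ⟩ (normal k) h (at ⟨ k ⟩ a k≤a)) (at ⟨ k ⟩ a k≤a)
        invariant {h} h∈ = Φ.trans ⟨ k ⟩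
          (Φ.sym ⟨ k ⟩ (res-act ⟨ k ⟩ ∣ a ∣ (normal k) (normal (proj₁ a)) k≤a h _))
          (≋-elim ⟨ k ⟩ (h ⊙ a) a k≤a k≤a (fixed h∈))

        preimage-of-a = GroupMorphisms.IsGroupIsomorphism.surjective (descent H ⟨ k ⟩ (normal k) k≤H)
          (at ⟨ k ⟩ a k≤a , λ (_ , h∈) → invariant h∈)

        x : Φ.Carrier H
        x = proj₁ preimage-of-a

        res-x : Φ._≈_ ⟨ k ⟩ (⟦ res ⟨ k ⟩ H k≤H ⟧ x) (at ⟨ k ⟩ a k≤a)
        res-x = proj₂ preimage-of-a (Φ.refl H)

      private module Ψ* = MackeyFunctor (fixedPoints germModule)

      opaque
        unfolding germModule

        θ : MackeyHom G Ψ (fixedPoints germModule)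
        θ = record
          { hom      = λ H → mkHom {A = Φ H} {B = FixedPoints.Fix germModule H}
              (λ x → θ₀ H x , θ₀-fixed H x) (θ₀-cong H) (θ₀-∙ H)
          ; comm-res = λ I H p x → germ-of-res {I} {H} (below I) (below H) p (below≤ I) (below≤ H) x
          ; comm-ind = θ₀-ind
          ; comm-con = θ₀-con
          }

        θ-injective : ∀ H {x y} → Ψ*.Φ._≈_ H (⟦ MackeyHom.hom θ H ⟧ x) (⟦ MackeyHom.hom θ H ⟧ y) →
                      Φ._≈_ H x y
        θ-injective H = θ₀-injective H

        θ-surjective : ∀ H (a : Ψ*.Φ.Carrier H) →
                       ∃[ x ] Ψ*.Φ._≈_ H (⟦ MackeyHom.hom θ H ⟧ x) a
        θ-surjective H (a , fixed) = θ₀-surjective H a fixed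

    -- Functoriality of the colimit

    opaque
      unfolding Germs.germModule

      germModule₁ : ∀ {Φ Ψ : Category.Obj (MackGal G)} → MackeyHom G (proj₁ Φ) (proj₁ Ψ) →
                    ModuleHom G (Germs.germModule (proj₁ Φ) (proj₂ Φ)) (Germs.germModule (proj₁ Ψ) (proj₂ Ψ))
      germModule₁ {Φ , dΦ} {Ψ , dΨ} f = record
        { hom = mkHom {A = Φ*.germs} {B = Ψ*.germs}
            (λ (i , x) → i , ⟦ f.hom ⟨ i ⟩ ⟧ x)
            (λ {a} {b} e → let W = Φ*.∣ a ∣ ∩ₒ Φ*.∣ b ∣ in
              Ψ*.agree (Ψ.Φ.trans W (Ψ.Φ.sym W (f.comm-res W Φ*.∣ a ∣ proj₁ (proj₂ a)))
                (Ψ.Φ.trans W (f-cong W (Φ*.agreement e)) (f.comm-res W Φ*.∣ b ∣ proj₂ (proj₂ b)))))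
            (λ a b → let k = proj₁ (a Φ*.⊕ b) in Ψ*.ι-cong k
              (Ψ.Φ.trans ⟨ k ⟩ (GroupHomomorphism.homo (f.hom ⟨ k ⟩) _ _)
                (Ψ.Φ.∙-cong ⟨ k ⟩ (f.comm-res ⟨ k ⟩ Φ*.∣ a ∣ (Φ*.⊕≤ˡ a b) (proj₂ a))
                                  (f.comm-res ⟨ k ⟩ Φ*.∣ b ∣ (Φ*.⊕≤ʳ a b) (proj₂ b)))))
        ; equivariant = λ g (i , x) → let U = ⟨ i ⟩ in Ψ*.ι-cong i
            (Ψ.Φ.trans U (f.comm-res U (conj g U) (proj₂ (normal-conj g {U} (normal i))) _)
              (Ψ*.res-cong U (conj g U) (proj₂ (normal-conj g {U} (normal i))) (f.comm-con g U x)))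
        }
        where
        module Φ* = Germs Φ dΦ
        module Ψ* = Germs Ψ dΨ
        module Ψ = MackeyFunctor Ψ
        module f = MackeyHom f
        f-cong : ∀ H {x y} → MackeyFunctor.Φ._≈_ Φ H x y → Ψ.Φ._≈_ H (⟦ f.hom H ⟧ x) (⟦ f.hom H ⟧ y)
        f-cong H = GroupHomomorphism.⟦⟧-cong (f.hom H)

      germModule₁-cong : ∀ {Φ Ψ : Category.Obj (MackGal G)} {f g : MackeyHom G (proj₁ Φ) (proj₁ Ψ)} →
        Category._≈_ (MackGal G) {Φ} {Ψ} f g →
        Category._≈_ (DiscreteModules G) (germModule₁ {Φ} {Ψ} f) (germModule₁ {Φ} {Ψ} g)
      germModule₁-cong {_} {Ψ} e (i , x) = Germs.ι-cong (proj₁ Ψ) (proj₂ Ψ) i (e ⟨ i ⟩ x)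

      germModule₁-id : ∀ {Φ : Category.Obj (MackGal G)} →
        Category._≈_ (DiscreteModules G) (germModule₁ {Φ} {Φ} (Category.id (MackGal G) {Φ}))
          (Category.id (DiscreteModules G))
      germModule₁-id {Φ} _ = Germs.≋-refl (proj₁ Φ) (proj₂ Φ)

      germModule₁-∘ : ∀ {Φ Ψ Ω : Category.Obj (MackGal G)}
        {f : MackeyHom G (proj₁ Φ) (proj₁ Ψ)} {g : MackeyHom G (proj₁ Ψ) (proj₁ Ω)} →
        Category._≈_ (DiscreteModules G)
          (germModule₁ {Φ} {Ω} (Category._∘_ (MackGal G) {Φ} {Ψ} {Ω} g f))
          (Category._∘_ (DiscreteModules G) (germModule₁ {Ψ} {Ω} g) (germModule₁ {Φ} {Ψ} f))
      germModule₁-∘ {Ω = Ω} _ = Germs.≋-refl (proj₁ Ω) (proj₂ Ω)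

    Colimit : Functor (MackGal G) (DiscreteModules G)
    Colimit = record
      { F₀           = λ (Ψ , d) → Germs.germModule Ψ d
      ; F₁           = λ {Φ} {Ψ} → germModule₁ {Φ} {Ψ}
      ; F-resp-≈     = λ {Φ} {Ψ} {f} {g} → germModule₁-cong {Φ} {Ψ} {f} {g}
      ; identity     = λ {Φ} → germModule₁-id {Φ}
      ; homomorphism = λ {Φ} {Ψ} {Ω} {f} {g} → germModule₁-∘ {Φ} {Ψ} {Ω} {f} {g}
      }

    -- The unit and the counit

    module Unit (M : DiscreteModule G) where
      private
        module M = DiscreteModule M
        module M* = Germs (fixedPoints M) (fixedPoints-descent M)
      open M using (_·_; ·-cong; ·-assoc; ·-ε)

      -- Openness comes from continuity of the action: {m} is open in the discrete topology, so each
      -- (g, m) with g · m = m has a box mapped into {m}, and its first factor stabilises m.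
      stabiliser : M.Carrier → OpenSubgroup
      stabiliser m = record
        { subset    = stab
        ; isOpen    = open-resp {⋃ V} {stab}
            (λ ((_ , g∈) , h∈) → let (_ , _ , _ , _ , _ , m∈ , box) = nbhd g∈ in box h∈ m∈)
            (λ {g} g∈ → (g , g∈) , (let (_ , _ , _ , _ , g∈V , _) = nbhd g∈ in g∈V))
            (open-⋃ V (λ (_ , g∈) → let (_ , _ , oV , _) = nbhd g∈ in oV))
        ; ε-closed  = ·-ε m
        ; ∙-closed  = λ {g} {h} g∈ h∈ → M.trans (·-assoc g h m) (M.trans (·-cong refl h∈) g∈)
        ; ⁻¹-closed = λ {g} g∈ → M.trans (·-cong refl (M.sym g∈))
            (M.trans (M.sym (·-assoc (g ⁻¹) g m)) (M.trans (·-cong (inverseˡ g) M.refl) (·-ε m)))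
        }
        where
        stab : Subset setoid
        stab = record
          { member = λ g → g · m M.≈ m
          ; resp   = λ e g∈ → M.trans (·-cong (sym e) M.refl) g∈ }
        point : Subset M.setoid
        point = record { member = M._≈ m ; resp = λ e x≈m → M.trans (M.sym e) x≈m }
        nbhd : ∀ {g} → g · m M.≈ m → _
        nbhd {g} = M.continuous point tt {g} {m}
        V : (∃[ g ] g · m M.≈ m) → Subset setoid
        V (_ , g∈) = proj₁ (nbhd g∈)

      opaque
        unfolding Germs.germModule

        -- An element m is viewed at a normal level inside its stabiliser. Restrictions between
        -- fixed points are inclusions, so equality of germs is equality in M, and the level may be
        -- forgotten again.
        η : ModuleHom G M (Germs.germModule (fixedPoints M) (fixedPoints-descent M))
        η = record
          { hom         = mkHom {A = M.M} {B = M*.germs}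
              (λ m → let (i , i≤) = cofinal (stabiliser m) in i , m , λ h∈ → i≤ h∈)
              M*.agree (λ _ _ → M*.agree M.refl)
          ; equivariant = λ _ _ → M*.agree M.refl
          }

        η⁻¹ : ModuleHom G (Germs.germModule (fixedPoints M) (fixedPoints-descent M)) M
        η⁻¹ = record
          { hom         = mkHom {A = M*.germs} {B = M.M}
              (λ (_ , m , _) → m) M*.agreement (λ _ _ → M.refl)
          ; equivariant = λ _ _ → M.refl
          }

    opaque
      unfolding Unit.η germModule₁

      unit : NaturalIsomorphism idF (Colimit ∘F Fixed)
      unit = record
        { η       = Unit.η
        ; η⁻¹     = Unit.η⁻¹
        ; isoˡ    = λ M _ → DiscreteModule.refl M
        ; isoʳ    = λ M _ → Germs.agree (DiscreteModule.refl M)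
        ; commute = λ {_} {N} _ _ → Germs.agree (DiscreteModule.refl N)
        }

    opaque
      unfolding Germs.θ germModule₁

      -- The level chosen below H depends on H alone and not on the functor, so both sides are germs
      -- at the same level, and f commutes with restriction to it.
      θ-natural : ∀ X Y (f : MackeyHom G (proj₁ X) (proj₁ Y)) H x →
        let (Φ , dΦ) = X
            (Ψ , dΨ) = Y
        in AbelianGroup._≈_ (MackeyFunctor.Φ (fixedPoints (Germs.germModule Ψ dΨ)) H)
             (⟦ MackeyHom.hom (Germs.θ Ψ dΨ) H ⟧ (⟦ MackeyHom.hom f H ⟧ x))
             (⟦ MackeyHom.hom (fixedPoints₁ (germModule₁ {X} {Y} f)) H ⟧
               (⟦ MackeyHom.hom (Germs.θ Φ dΦ) H ⟧ x))
      θ-natural (Φ , dΦ) (Ψ , dΨ) f H x = Germs.ι-cong Ψ dΨ i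
        (AbelianGroup.sym (MackeyFunctor.Φ Ψ ⟨ i ⟩)
          (MackeyHom.comm-res f ⟨ i ⟩ H (Germs.below≤ Φ dΦ H) x))
        where
        i : Index
        i = Germs.below Φ dΦ H

    counit : NaturalIsomorphism (Fixed ∘F Colimit) idF
    counit = record
      { η       = λ (Ψ , d) →
                    inverseHom (Germs.θ Ψ d) (Germs.θ-injective Ψ d) (Germs.θ-surjective Ψ d)
      ; η⁻¹     = λ (Ψ , d) → Germs.θ Ψ d
      ; isoˡ    = λ (Ψ , d) H a → proj₂ (Germs.θ-surjective Ψ d H a)
      ; isoʳ    = λ (Ψ , d) H x →
                    Germs.θ-injective Ψ d H
                      (proj₂ (Germs.θ-surjective Ψ d H (⟦ MackeyHom.hom (Germs.θ Ψ d) H ⟧ x)))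
      ; commute = λ {X} {Y} f →
          let (Φ , dΦ) = X
              (Ψ , dΨ) = Y
          in inverse-natural (Germs.θ Φ dΦ) (Germs.θ Ψ dΨ) f (fixedPoints₁ (germModule₁ {X} {Y} f))
               (Germs.θ-surjective Φ dΦ) (Germs.θ-injective Ψ dΨ) (Germs.θ-surjective Ψ dΨ)
               (θ-natural X Y f)
      }

corollary2p3p23 : ∀ {ℓ : Level} → ExcludedMiddle (suc ℓ) → (G : ProfiniteGroup ℓ) → Equivalence (DiscreteModules G) (MackGal G)
corollary2p3p23 em G = record
  { F      = Classical.Fixed G em
  ; G      = Classical.Colimit G em
  ; unit   = Classical.unit G em
  ; counit = Classical.counit G em
  }
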